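{- Let $\widehat\alpha_k=q^{6r^2-r}-q^{6r^2-2r}$ if $k=3r-1$, $\widehat\alpha_k=q^{6r^2+2r}$ if $k=3r$, $\widehat\alpha_k=-q^{6r^2+7r+2}$ if $k=3r+1$. Then for every integer $p\ge1$, every positive integer $N$ and every primitive $N$th root of unity $q$, $$-\frac12+H_p^{(10)}(q)=q^p\left(\sum_{k=0}^{N-2}(-1)^kq^{ -\binom{k+1}{2}+p(k^2+2k)}\widehat\alpha_k+\frac12q^{ -p}\widehat\alpha_{N-1}\right).$$
   Context: $(a)_n=\prod_{k=1}^n(1-aq^{k-1})$, $\begin{bmatrix} n\\ k\end{bmatrix}=\frac{(q)_n}{(q)_{n-k}(q)_k}$. $H_p^{(10)}(q)=\sum_{n_p\ge\cdots\ge n_1\ge0}q^{ -n_p^2}(q^{n_p})_{n_p}\prod_{i=1}^{p-1}q^{n_i^2}\begin{bmatrix} n_{i+1}\\ n_i\end{bmatrix}$; at a root of unity only finitely many terms are nonzero. (In the paper $\widehat\alpha_k=\frac{1-q}{1-q^{k+1}}\alpha_k$ where $\alpha_k=\frac{1-q^{k+1}}{1-q}\widehat\alpha_k$ is part of a Bailey pair relative to $q^2$.) -}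

module Defs where

open import Level using (Level; _⊔_) renaming (suc to lsuc)
open import Data.Nat as ℕ using (ℕ; zero; suc)
open import Data.Nat.Combinatorics using (_C_)
open import Data.Integer as ℤ using (ℤ; +_; -[1+_])
open import Data.Fin using (Fin)
open import Relation.Nullary using (¬_)
open import Algebra.Bundles using (CommutativeRing)
open import Data.Product using (_×_)

nTimesOne : ∀ {c} {A : Set c} → A → A → (A → A → A) → ℕ → A
nTimesOne zero0 one _+'_ zero = zero0
nTimesOne zero0 one _+'_ (suc n) = one +' nTimesOne zero0 one _+'_ n

record Field0 (c ℓ : Level) : Set (lsuc (c ⊔ ℓ)) where
  field
    commRing : CommutativeRing c ℓ
  open CommutativeRing commRing public
  field
    inv     : Carrier → Carrier
    inv-r   : ∀ x → ¬ (x ≈ 0#) → x * inv x ≈ 1#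
    1≉0     : ¬ (1# ≈ 0#)
    char0   : ∀ n → ¬ (nTimesOne 0# 1# _+_ (suc n) ≈ 0#)

module _ {c ℓ : Level} (F : Field0 c ℓ) where
  open Field0 F

  pow : Carrier → ℕ → Carrier
  pow x zero = 1#
  pow x (suc n) = x * pow x n

  zpow : Carrier → ℤ → Carrier
  zpow x (+ n) = pow x n
  zpow x -[1+ n ] = pow (inv x) (suc n)

  sumTo : ℕ → (ℕ → Carrier) → Carrier
  sumTo zero f = 0#
  sumTo (suc n) f = sumTo n f + f n

  PrimitiveRoot : ℕ → Carrier → Set ℓ
  PrimitiveRoot N q = (pow q N ≈ 1#) × (∀ k → 0 ℕ.< k → k ℕ.< N → ¬ (pow q k ≈ 1#))

  poch : Carrier → Carrier → ℕ → Carrier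
  poch q a zero = 1#
  poch q a (suc n) = poch q a n * (1# - a * pow q n)

  qbin : Carrier → ℕ → ℕ → Carrier
  qbin q n k = poch q q n * inv (poch q q (n ℕ.∸ k) * poch q q k)

  -- chains: G q j m = Σ_{m ≥ n_j ≥ ... ≥ n_1 ≥ 0} ∏_{i=1}^{j} q^{n_i^2} [n_{i+1} n_i]
  -- with n_{j+1} = m
  chainSum : Carrier → ℕ → ℕ → Carrier
  chainSum q zero m = 1#
  chainSum q (suc j) m = sumTo (suc m) (λ n → pow q (n ℕ.* n) * qbin q m n * chainSum q j n)

  -- H_p^{(10)}(q) with the outer sum n_p truncated to 0 ≤ n_p ≤ M
  H10 : Carrier → ℕ → ℕ → Carrier
  H10 q p M = sumTo (suc M) (λ n →
      zpow q (ℤ.- (+ (n ℕ.* n))) * poch q (pow q n) n * chainSum q (p ℕ.∸ 1) n)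

  alphaHat : Carrier → ℕ → Carrier
  alphaHat q k = go (k ℕ.% 3)
    where
      s : ℕ
      s = k ℕ./ 3
      go : ℕ → Carrier
      go 0 = pow q (6 ℕ.* s ℕ.* s ℕ.+ 2 ℕ.* s)
      go 1 = - pow q (6 ℕ.* s ℕ.* s ℕ.+ 7 ℕ.* s ℕ.+ 2)
      -- k = 3r-1, r = s+1 (k % 3 = 2)
      go _ = pow q (6 ℕ.* suc s ℕ.* suc s ℕ.∸ suc s) - pow q (6 ℕ.* suc s ℕ.* suc s ℕ.∸ 2 ℕ.* suc s)

  half : Carrier
  half = inv (1# + 1#)

  rhs216 : Carrier → ℕ → ℕ → Carrier
  rhs216 q N p = pow q p *
    ( sumTo (N ℕ.∸ 1) (λ k →
        pow (- 1#) k
        * zpow q (ℤ.- (+ (suc k C 2)) ℤ.+ (+ (p ℕ.* (k ℕ.* k ℕ.+ 2 ℕ.* k))))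
        * alphaHat q k)
    + half * zpow q (ℤ.- (+ p)) * alphaHat q (N ℕ.∸ 1))

{-# OPTIONS --safe #-}
module Submission where

-- Put m = k + 1, α m = α̂ₘ₋₁ and λₘⱼ = qʲ (qᵐ)ⱼ (q⁻ᵐ)ⱼ / (q)ⱼ.  By q-Chu-Vandermonde, summation
-- against λₘ turns the step g ↦ ∑ₙ q^(n²) [j n] g(n) of the chain into multiplication by
-- q^(m²), so that ∑ⱼ λₘⱼ chainSum (p-1) j = q^(p m²) for m < N.  It remains to expand the outer
-- weight: for 0 < n < N,
--     q^(-n²) (qⁿ)ₙ = ∑_{0<m<N} (-1)^(m-1) q^(-m(m-1)/2) α m λₘₙ,
-- while for n = 0 the right-hand side is ½ - ½ α N; exchanging the summations gives the theorem.
-- Write α m = X m - q⁻ᵐ X(-m) with X supported on m ≡ 0, 2 (mod 3).  The case n = 0 telescopes.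
-- For n > 0, the q-Pascal rules and two reflections of X give, for every q and ν,
--     ∑ₘ X m [2ν, ν-m] = 1   and   ∑ₘ qᵐ X m [2ν, ν-m] = q^ν;
-- at q^N = 1 and ν = N - n their difference folds onto ∑ₘ (1 - qᵐ) α m [N-2n, m-n] = 1 - q⁻ⁿ,
-- whose weights are the λₘₙ up to elementary factors.

open import Defs
open import Level using (Level)
open import Data.Nat as ℕ using (ℕ; zero; suc; s≤s; z≤n; _≤_)
import Data.Nat.Properties as ℕₚ
import Data.Nat.DivMod as DM
open import Data.Nat.Combinatorics using (nC1≡n; nCk+nC[k+1]≡[n+1]C[k+1])
  renaming (_C_ to _choose_)
open import Data.Integer as ℤ using (ℤ; +_; -[1+_])
import Data.Integer.Properties as ℤₚ
open import Data.Integer.Tactic.RingSolver using (solve-∀)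
open import Data.Maybe using (Maybe; just; nothing)
open import Data.Product using (_,_; proj₁; proj₂)
open import Relation.Nullary using (¬_; yes; no)
open import Relation.Binary.PropositionalEquality as ≡ using (_≡_)
open import Algebra.Bundles using (CommutativeRing)
import Algebra.Solver.Ring as RingSolver
open import Algebra.Solver.Ring.AlmostCommutativeRing
  using (fromCommutativeRing; _-Raw-AlmostCommutative⟶_)

-- The rows 2ν = 2(N - n) reach or pass N as soon as 2n ≤ N, where (q)_N = 0 forbids quotients of
-- factorials. Hence the two sums over X are proved for every nonzero q from the Pascal recursion
-- alone, and q^N = 1 enters afterwards: the rule [a+N, k] = [a, k] + [a, k-N] splits row 2ν = a +
-- N, with a = N - 2n, into two copies of row a, one carrying m ≥ n and the other m ≤ -n. The
-- sequence α combines X m and X(-m) so that both copies become a single one-sided sum. The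
-- reflections are m ↦ -1-m for qᵐ X m and m ↦ 2-m for q⁻ᵐ X m. Their composite is the translation
-- by 3, whence the residues modulo 3 and the exponent m(2m-1)/3. The expansion of the outer weight
-- appears only after multiplication by 1 - qⁿ, so n = 0 escapes the argument. There the expansion
-- gives ½ - ½ α N in place of 1, and the deficit ½ + ½ α N accounts for both the constant ½ and the
-- boundary term of the theorem.

-- The ring solver with integer coefficients, so that it sees cancellation
-- in a commutative ring without decidable equality.
module IntegerCoefficients {c ℓ} (R : CommutativeRing c ℓ) where
  open CommutativeRing R
  open import Algebra.Properties.Ring ring
  open import Algebra.Properties.AbelianGroup +-abelianGroup using (⁻¹-∙-comm)
  open import Algebra.Properties.Semiring.Mult.TCOptimised semiring
    using (1+×; ×-homo-+; ×1-homo-*) renaming (_×_ to _·_)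
  open import Relation.Binary.Reasoning.Setoid setoid

  -- The optimised multiple makes `⟦ + 1 ⟧` reduce to `1#`, so that `con (+ 1)` in a solver goal
  -- matches `1#` by `refl`.
  ⟦_⟧ : ℤ → Carrier
  ⟦ + n ⟧      = n · 1#
  ⟦ -[1+ n ] ⟧ = - (suc n · 1#)

  ⟦⟧-neg : ∀ i → ⟦ ℤ.- i ⟧ ≈ - ⟦ i ⟧
  ⟦⟧-neg (+ zero)    = sym -0#≈0#
  ⟦⟧-neg (+ suc n)   = refl
  ⟦⟧-neg -[1+ n ]    = sym (-‿involutive _)

  ⟦⟧-⊖ : ∀ m n → ⟦ m ℤ.⊖ n ⟧ ≈ m · 1# - n · 1#
  ⟦⟧-⊖ m       zero    = begin
    ⟦ m ℤ.⊖ 0 ⟧  ≡⟨ ≡.cong ⟦_⟧ (ℤₚ.⊖-≥ {m} z≤n) ⟩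
    m · 1#       ≈⟨ +-identityʳ _ ⟨
    m · 1# + 0#  ≈⟨ +-congˡ -0#≈0# ⟨
    m · 1# - 0#  ∎
  ⟦⟧-⊖ zero    (suc n) = sym (+-identityˡ _)
  ⟦⟧-⊖ (suc m) (suc n) = begin
    ⟦ suc m ℤ.⊖ suc n ⟧                ≡⟨ ≡.cong ⟦_⟧ (ℤₚ.[1+m]⊖[1+n]≡m⊖n m n) ⟩
    ⟦ m ℤ.⊖ n ⟧                        ≈⟨ ⟦⟧-⊖ m n ⟩
    m · 1# - n · 1#                    ≈⟨ +-identityˡ _ ⟨
    0# + (m · 1# - n · 1#)             ≈⟨ +-congʳ (-‿inverseʳ 1#) ⟨
    (1# - 1#) + (m · 1# - n · 1#)      ≈⟨ +-interchange _ _ _ _ ⟩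
    (1# + m · 1#) + (- 1# - n · 1#)    ≈⟨ +-congˡ (⁻¹-∙-comm _ _) ⟩
    (1# + m · 1#) - (1# + n · 1#)      ≈⟨ +-cong (1+× m 1#) (-‿cong (1+× n 1#)) ⟨
    suc m · 1# - suc n · 1#            ∎
    where
      open import Algebra.Properties.CommutativeSemigroup +-commutativeSemigroup
        renaming (interchange to +-interchange)

  ⟦⟧-+ : ∀ i j → ⟦ i ℤ.+ j ⟧ ≈ ⟦ i ⟧ + ⟦ j ⟧
  ⟦⟧-+ (+ m)    (+ n)    = ×-homo-+ 1# m n
  ⟦⟧-+ (+ m)    -[1+ n ] = ⟦⟧-⊖ m (suc n)
  ⟦⟧-+ -[1+ m ] (+ n)    = trans (⟦⟧-⊖ n (suc m)) (+-comm _ _)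
  ⟦⟧-+ -[1+ m ] -[1+ n ] = begin
    - (suc (suc (m ℕ.+ n)) · 1#)       ≡⟨ ≡.cong (λ k → - (k · 1#)) (ℕₚ.+-suc (suc m) n) ⟨
    - ((suc m ℕ.+ suc n) · 1#)         ≈⟨ -‿cong (×-homo-+ 1# (suc m) (suc n)) ⟩
    - (suc m · 1# + suc n · 1#)        ≈⟨ ⁻¹-∙-comm _ _ ⟨
    - (suc m · 1#) - (suc n · 1#)      ∎

  ⟦⟧-*-pos : ∀ m j → ⟦ + m ℤ.* j ⟧ ≈ ⟦ + m ⟧ * ⟦ j ⟧
  ⟦⟧-*-pos m (+ n)    = begin
    ⟦ + m ℤ.* + n ⟧        ≡⟨ ≡.cong ⟦_⟧ (ℤₚ.pos-* m n) ⟨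
    (m ℕ.* n) · 1#         ≈⟨ ×1-homo-* m n ⟩
    (m · 1#) * (n · 1#)    ∎
  ⟦⟧-*-pos m -[1+ n ] = begin
    ⟦ + m ℤ.* -[1+ n ] ⟧          ≡⟨ ≡.cong ⟦_⟧ (ℤₚ.neg-distribʳ-* (+ m) (+ suc n)) ⟨
    ⟦ ℤ.- (+ m ℤ.* + suc n) ⟧     ≈⟨ ⟦⟧-neg (+ m ℤ.* + suc n) ⟩
    - ⟦ + m ℤ.* + suc n ⟧         ≈⟨ -‿cong (⟦⟧-*-pos m (+ suc n)) ⟩
    - ((m · 1#) * (suc n · 1#))   ≈⟨ -‿distribʳ-* _ _ ⟩
    (m · 1#) * - (suc n · 1#)     ∎

  ⟦⟧-* : ∀ i j → ⟦ i ℤ.* j ⟧ ≈ ⟦ i ⟧ * ⟦ j ⟧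
  ⟦⟧-* (+ m)    j = ⟦⟧-*-pos m j
  ⟦⟧-* -[1+ m ] j = begin
    ⟦ -[1+ m ] ℤ.* j ⟧            ≡⟨ ≡.cong ⟦_⟧ (ℤₚ.neg-distribˡ-* (+ suc m) j) ⟨
    ⟦ ℤ.- (+ suc m ℤ.* j) ⟧       ≈⟨ ⟦⟧-neg (+ suc m ℤ.* j) ⟩
    - ⟦ + suc m ℤ.* j ⟧           ≈⟨ -‿cong (⟦⟧-*-pos (suc m) j) ⟩
    - ((suc m · 1#) * ⟦ j ⟧)      ≈⟨ -‿distribˡ-* _ _ ⟩
    - (suc m · 1#) * ⟦ j ⟧        ∎

  morphism : CommutativeRing.rawRing ℤₚ.+-*-commutativeRing
             -Raw-AlmostCommutative⟶ fromCommutativeRing R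
  morphism = record
    { ⟦_⟧    = ⟦_⟧
    ; +-homo = ⟦⟧-+
    ; *-homo = ⟦⟧-*
    ; -‿homo = ⟦⟧-neg
    ; 0-homo = refl
    ; 1-homo = refl
    }

  private
    _≟_ : ∀ i j → Maybe (⟦ i ⟧ ≈ ⟦ j ⟧)
    i ≟ j with i ℤ.≟ j
    ... | yes ≡.refl = just refl
    ... | no  _      = nothing

  open RingSolver _ (fromCommutativeRing R) morphism _≟_ public
    using (solve; _:=_; _:+_; _:*_; _:-_; :-_; con)

-- Cancellation, finite sums and powers in a field of characteristic zero.

module FieldArithmetic {c ℓ} (F : Field0 c ℓ) where
  open Field0 F
  open import Relation.Binary.Reasoning.Setoid setoid
  open import Algebra.Properties.Ring ring public using (-‿involutive)
  open IntegerCoefficients commRing public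
    using (solve; _:=_; _:+_; _:*_; _:-_; :-_; con)

  Nonzero : Carrier → Set ℓ
  Nonzero x = ¬ (x ≈ 0#)

  *-cancelˡ-nonzero : ∀ {x y z} → Nonzero x → x * y ≈ x * z → y ≈ z
  *-cancelˡ-nonzero {x} {y} {z} x≉0 e = begin
    y                  ≈⟨ unfold y ⟩
    inv x * (x * y)    ≈⟨ *-congˡ e ⟩
    inv x * (x * z)    ≈⟨ unfold z ⟨
    z                  ∎
    where
      unfold : ∀ w → w ≈ inv x * (x * w)
      unfold w = begin
        w                ≈⟨ *-identityˡ w ⟨
        1# * w           ≈⟨ *-congʳ (inv-r x x≉0) ⟨
        x * inv x * w    ≈⟨ solve 3 (λ x i w → x :* i :* w := i :* (x :* w)) refl x (inv x) w ⟩
        inv x * (x * w)  ∎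

  *-nonzero : ∀ {x y} → Nonzero x → Nonzero y → Nonzero (x * y)
  *-nonzero {x} {y} x≉0 y≉0 xy≈0 =
    y≉0 (*-cancelˡ-nonzero x≉0 (trans xy≈0 (sym (zeroʳ x))))

  Nonzero-resp : ∀ {x y} → x ≈ y → Nonzero x → Nonzero y
  Nonzero-resp x≈y x≉0 y≈0 = x≉0 (trans x≈y y≈0)

  1-x-nonzero : ∀ {x} → ¬ (x ≈ 1#) → Nonzero (1# - x)
  1-x-nonzero {x} x≉1 e = x≉1 (begin
    x                ≈⟨ solve 1 (λ x → x := con (+ 1) :- (con (+ 1) :- x)) refl x ⟩
    1# - (1# - x)    ≈⟨ +-congˡ (-‿cong e) ⟩
    1# - 0#          ≈⟨ solve 0 (con (+ 1) :- con (+ 0) := con (+ 1)) refl ⟩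
    1#               ∎)

  2# : Carrier
  2# = 1# + 1#

  2-nonzero : Nonzero 2#
  2-nonzero = Nonzero-resp (+-congˡ (+-identityʳ 1#)) (char0 1)

  half+half : half F + half F ≈ 1#
  half+half = trans (solve 1 (λ h → h :+ h := (con (+ 1) :+ con (+ 1)) :* h) refl (half F))
                    (inv-r 2# 2-nonzero)

  x≈-x⇒x≈0 : ∀ {x} → x ≈ - x → x ≈ 0#
  x≈-x⇒x≈0 {x} e = *-cancelˡ-nonzero 2-nonzero (begin
    2# * x      ≈⟨ solve 1 (λ x → (con (+ 1) :+ con (+ 1)) :* x := x :+ x) refl x ⟩
    x + x       ≈⟨ +-congˡ e ⟩
    x - x       ≈⟨ solve 1 (λ x → x :- x := (con (+ 1) :+ con (+ 1)) :* con (+ 0)) refl x ⟩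
    2# * 0#     ∎)

  ∑ : ℕ → (ℕ → Carrier) → Carrier
  ∑ = sumTo F

  ∑-cong< : ∀ n {f g} → (∀ k → k ℕ.< n → f k ≈ g k) → ∑ n f ≈ ∑ n g
  ∑-cong< zero    e = refl
  ∑-cong< (suc n) e =
    +-cong (∑-cong< n (λ k k<n → e k (ℕₚ.m<n⇒m<1+n k<n))) (e n ℕₚ.≤-refl)

  ∑-cong : ∀ n {f g} → (∀ k → f k ≈ g k) → ∑ n f ≈ ∑ n g
  ∑-cong n e = ∑-cong< n (λ k _ → e k)

  ∑-zero : ∀ n → ∑ n (λ _ → 0#) ≈ 0#
  ∑-zero zero    = refl
  ∑-zero (suc n) = trans (+-identityʳ _) (∑-zero n)

  ∑-zero< : ∀ n {f} → (∀ k → k ℕ.< n → f k ≈ 0#) → ∑ n f ≈ 0#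
  ∑-zero< n e = trans (∑-cong< n e) (∑-zero n)

  ∑-+ : ∀ n f g → ∑ n (λ k → f k + g k) ≈ ∑ n f + ∑ n g
  ∑-+ zero    f g = sym (+-identityʳ 0#)
  ∑-+ (suc n) f g = trans (+-congʳ (∑-+ n f g))
    (solve 4 (λ a b c d → a :+ b :+ (c :+ d) := a :+ c :+ (b :+ d)) refl _ _ _ _)

  *-distribˡ-∑ : ∀ x n f → x * ∑ n f ≈ ∑ n (λ k → x * f k)
  *-distribˡ-∑ x zero    f = zeroʳ x
  *-distribˡ-∑ x (suc n) f = trans (distribˡ x _ _) (+-congʳ (*-distribˡ-∑ x n f))

  *-distribʳ-∑ : ∀ x n f → ∑ n f * x ≈ ∑ n (λ k → f k * x)
  *-distribʳ-∑ x zero    f = zeroˡ x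
  *-distribʳ-∑ x (suc n) f = trans (distribʳ x _ _) (+-congʳ (*-distribʳ-∑ x n f))

  ∑-split : ∀ m n f → ∑ (m ℕ.+ n) f ≈ ∑ m f + ∑ n (λ k → f (m ℕ.+ k))
  ∑-split m zero f rewrite ℕₚ.+-identityʳ m = sym (+-identityʳ _)
  ∑-split m (suc n) f rewrite ℕₚ.+-suc m n =
    trans (+-congʳ (∑-split m n f)) (+-assoc _ _ _)

  ∑-head : ∀ n f → ∑ (suc n) f ≈ f 0 + ∑ n (λ k → f (suc k))
  ∑-head n f = trans (∑-split 1 n f) (+-congʳ (+-identityˡ _))

  -- Lets sums run uniformly up to N, as exchanges of summation require, and be cut back to the
  -- support of the summand where needed.
  ∑-window : ∀ a b c f →
    (∀ k → k ℕ.< a → f k ≈ 0#) → (∀ k → a ℕ.+ b ℕ.≤ k → k ℕ.< a ℕ.+ b ℕ.+ c → f k ≈ 0#) →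
    ∑ (a ℕ.+ b ℕ.+ c) f ≈ ∑ b (λ k → f (a ℕ.+ k))
  ∑-window a b c f below above = begin
    ∑ (a ℕ.+ b ℕ.+ c) f
      ≈⟨ ∑-split (a ℕ.+ b) c f ⟩
    ∑ (a ℕ.+ b) f + ∑ c (λ k → f (a ℕ.+ b ℕ.+ k))
      ≈⟨ +-congˡ (∑-zero< c (λ k k<c → above _ (ℕₚ.m≤m+n (a ℕ.+ b) k) (ℕₚ.+-monoʳ-< (a ℕ.+ b) k<c))) ⟩
    ∑ (a ℕ.+ b) f + 0#
      ≈⟨ +-identityʳ _ ⟩
    ∑ (a ℕ.+ b) f
      ≈⟨ ∑-split a b f ⟩
    ∑ a f + ∑ b (λ k → f (a ℕ.+ k))
      ≈⟨ +-congʳ (∑-zero< a below) ⟩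
    0# + ∑ b (λ k → f (a ℕ.+ k))
      ≈⟨ +-identityˡ _ ⟩
    ∑ b (λ k → f (a ℕ.+ k))  ∎

  ∑-swap : ∀ m n (f : ℕ → ℕ → Carrier) →
    ∑ m (λ i → ∑ n (λ j → f i j)) ≈ ∑ n (λ j → ∑ m (λ i → f i j))
  ∑-swap zero    n f = sym (∑-zero n)
  ∑-swap (suc m) n f = begin
    ∑ m (λ i → ∑ n (f i)) + ∑ n (f m)           ≈⟨ +-congʳ (∑-swap m n f) ⟩
    ∑ n (λ j → ∑ m (λ i → f i j)) + ∑ n (f m)   ≈⟨ ∑-+ n _ _ ⟨
    ∑ n (λ j → ∑ (suc m) (λ i → f i j))         ∎

  pow-cong : ∀ {x y} n → x ≈ y → pow F x n ≈ pow F y n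
  pow-cong zero    e = refl
  pow-cong (suc n) e = *-cong e (pow-cong n e)

  pow-+ : ∀ x m n → pow F x (m ℕ.+ n) ≈ pow F x m * pow F x n
  pow-+ x zero    n = sym (*-identityˡ _)
  pow-+ x (suc m) n = trans (*-congˡ (pow-+ x m n)) (sym (*-assoc _ _ _))

  pow-1 : ∀ n → pow F 1# n ≈ 1#
  pow-1 zero    = refl
  pow-1 (suc n) = trans (*-identityˡ _) (pow-1 n)

-- Integer powers of q, shifted factorials and Gaussian binomials at any nonzero q.

module QCalculus {c ℓ} (F : Field0 c ℓ) (q : Field0.Carrier F)
                 (q≉0 : ¬ (Field0._≈_ F q (Field0.0# F))) where
  open Field0 F
  open import Relation.Binary.Reasoning.Setoid setoid
  open FieldArithmetic F

  Q : ℤ → Carrier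
  Q = zpow F q

  Q-≡ : ∀ {i j} → i ≡ j → Q i ≈ Q j
  Q-≡ e = reflexive (≡.cong Q e)

  private
    q′ = inv q

    pow-cancel : ∀ n → pow F q n * pow F q′ n ≈ 1#
    pow-cancel zero    = *-identityˡ 1#
    pow-cancel (suc n) = begin
      q * pow F q n * (q′ * pow F q′ n)
        ≈⟨ solve 4 (λ a b c d → a :* b :* (c :* d) := a :* c :* (b :* d)) refl _ _ _ _ ⟩
      q * q′ * (pow F q n * pow F q′ n)
        ≈⟨ *-cong (inv-r q q≉0) (pow-cancel n) ⟩
      1# * 1#
        ≈⟨ *-identityˡ 1# ⟩
      1# ∎

    Q-⊖ : ∀ m n → Q (m ℤ.⊖ n) ≈ pow F q m * pow F q′ n
    Q-⊖ m       zero    = trans (Q-≡ (ℤₚ.⊖-≥ {m} z≤n)) (sym (*-identityʳ _))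
    Q-⊖ zero    (suc n) = sym (*-identityˡ _)
    Q-⊖ (suc m) (suc n) = begin
      Q (suc m ℤ.⊖ suc n)                   ≈⟨ Q-≡ (ℤₚ.[1+m]⊖[1+n]≡m⊖n m n) ⟩
      Q (m ℤ.⊖ n)                           ≈⟨ Q-⊖ m n ⟩
      pow F q m * pow F q′ n                ≈⟨ *-identityˡ _ ⟨
      1# * (pow F q m * pow F q′ n)         ≈⟨ *-congʳ (inv-r q q≉0) ⟨
      q * q′ * (pow F q m * pow F q′ n)
        ≈⟨ solve 4 (λ a b c d → a :* b :* (c :* d) := a :* c :* (b :* d)) refl _ _ _ _ ⟩
      q * pow F q m * (q′ * pow F q′ n)     ∎

  Q-+ : ∀ i j → Q (i ℤ.+ j) ≈ Q i * Q j
  Q-+ (+ m)    (+ n)    = pow-+ q m n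
  Q-+ (+ m)    -[1+ n ] = Q-⊖ m (suc n)
  Q-+ -[1+ m ] (+ n)    = trans (Q-⊖ n (suc m)) (*-comm _ _)
  Q-+ -[1+ m ] -[1+ n ] = begin
    pow F q′ (suc (suc (m ℕ.+ n)))  ≡⟨ ≡.cong (pow F q′) (ℕₚ.+-suc (suc m) n) ⟨
    pow F q′ (suc m ℕ.+ suc n)      ≈⟨ pow-+ q′ (suc m) (suc n) ⟩
    pow F q′ (suc m) * pow F q′ (suc n) ∎

  Q-*-≡ : ∀ i j {k} → i ℤ.+ j ≡ k → Q i * Q j ≈ Q k
  Q-*-≡ i j e = trans (sym (Q-+ i j)) (Q-≡ e)

  Q-inverse : ∀ i → Q i * Q (ℤ.- i) ≈ 1#
  Q-inverse i = Q-*-≡ i (ℤ.- i) (ℤₚ.+-inverseʳ i)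

  pow-Q : ∀ i n → pow F (Q i) n ≈ Q (+ n ℤ.* i)
  pow-Q i zero    = refl
  pow-Q i (suc n) = trans (*-congˡ (pow-Q i n)) (Q-*-≡ i (+ n ℤ.* i) (eq i (+ n)))
    where
      eq : ∀ i n → i ℤ.+ n ℤ.* i ≡ (+ 1 ℤ.+ n) ℤ.* i
      eq = solve-∀

  poch-cong : ∀ {a b} n → a ≈ b → poch F q a n ≈ poch F q b n
  poch-cong zero    e = refl
  poch-cong (suc n) e = *-cong (poch-cong n e) (+-congˡ (-‿cong (*-congʳ e)))

  poch-0 : ∀ n → poch F q 0# n ≈ 1#
  poch-0 zero    = refl
  poch-0 (suc n) = trans (*-congʳ (poch-0 n))
    (solve 1 (λ x → con (+ 1) :* (con (+ 1) :- con (+ 0) :* x) := con (+ 1)) refl _)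

  poch-vanish : ∀ {a} n k → k ℕ.< n → a * pow F q k ≈ 1# → poch F q a n ≈ 0#
  poch-vanish {a} (suc n) k k<1+n e with ℕ._≟_ k n
  ... | yes ≡.refl = begin
    poch F q a n * (1# - a * pow F q n)  ≈⟨ *-congˡ (+-congˡ (-‿cong e)) ⟩
    poch F q a n * (1# - 1#)             ≈⟨ *-congˡ (-‿inverseʳ 1#) ⟩
    poch F q a n * 0#                    ≈⟨ zeroʳ _ ⟩
    0#                                   ∎
  ... | no k≢n = trans (*-congʳ (poch-vanish n k (ℕₚ.≤∧≢⇒< (ℕₚ.≤-pred k<1+n) k≢n) e)) (zeroˡ _)

  poch-+ : ∀ i m n → poch F q (Q i) (m ℕ.+ n) ≈ poch F q (Q i) m * poch F q (Q (i ℤ.+ + m)) n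
  poch-+ i m zero rewrite ℕₚ.+-identityʳ m = sym (*-identityʳ _)
  poch-+ i m (suc n) rewrite ℕₚ.+-suc m n = begin
    poch F q (Q i) (m ℕ.+ n) * (1# - Q i * pow F q (m ℕ.+ n))
      ≈⟨ *-cong (poch-+ i m n) (+-congˡ (-‿cong shift)) ⟩
    poch F q (Q i) m * poch F q (Q (i ℤ.+ + m)) n * (1# - Q (i ℤ.+ + m) * pow F q n)
      ≈⟨ *-assoc _ _ _ ⟩
    poch F q (Q i) m * poch F q (Q (i ℤ.+ + m)) (suc n) ∎
    where
      shift : Q i * pow F q (m ℕ.+ n) ≈ Q (i ℤ.+ + m) * pow F q n
      shift = trans (Q-*-≡ i (+ (m ℕ.+ n)) (≡.sym (ℤₚ.+-assoc i (+ m) (+ n)))) (Q-+ (i ℤ.+ + m) (+ n))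

  -- Both sides are (qⁱ)ₙ₊₁, with the first or the last factor split off.
  poch-shift : ∀ i n → (1# - Q i) * poch F q (Q (i ℤ.+ + 1)) n ≈ poch F q (Q i) n * (1# - Q (i ℤ.+ + n))
  poch-shift i n = begin
    (1# - Q i) * poch F q (Q (i ℤ.+ + 1)) n
      ≈⟨ *-congʳ (solve 1 (λ x → con (+ 1) :- x := con (+ 1) :* (con (+ 1) :- x :* con (+ 1))) refl (Q i)) ⟩
    poch F q (Q i) 1 * poch F q (Q (i ℤ.+ + 1)) n
      ≈⟨ poch-+ i 1 n ⟨
    poch F q (Q i) n * (1# - Q i * pow F q n)
      ≈⟨ *-congˡ (+-congˡ (-‿cong (Q-+ i (+ n)))) ⟨
    poch F q (Q i) n * (1# - Q (i ℤ.+ + n)) ∎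

  -- Gaussian binomials by the q-Pascal rule, meaningful even where (q)ₙ vanishes.
  gb : ℕ → ℕ → Carrier
  gb n       zero    = 1#
  gb zero    (suc k) = 0#
  gb (suc n) (suc k) = gb n k + Q (+ suc k) * gb n (suc k)

  gb-> : ∀ n k → n ℕ.< k → gb n k ≈ 0#
  gb-> zero    (suc k) _         = refl
  gb-> (suc n) (suc k) (s≤s n<k) = begin
    gb n k + Q (+ suc k) * gb n (suc k)
      ≈⟨ +-cong (gb-> n k n<k) (*-congˡ (gb-> n (suc k) (ℕₚ.m<n⇒m<1+n n<k))) ⟩
    0# + Q (+ suc k) * 0#
      ≈⟨ trans (+-identityˡ _) (zeroʳ _) ⟩
    0# ∎

  gb-diag : ∀ n → gb n n ≈ 1#
  gb-diag zero    = refl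
  gb-diag (suc n) = begin
    gb n n + Q (+ suc n) * gb n (suc n)   ≈⟨ +-cong (gb-diag n) (*-congˡ (gb-> n (suc n) ℕₚ.≤-refl)) ⟩
    1# + Q (+ suc n) * 0#                 ≈⟨ trans (+-congˡ (zeroʳ _)) (+-identityʳ 1#) ⟩
    1#                                    ∎

  -- The quotient of neighbouring binomials in division-free form, still valid where 1 - q^(k+1)
  -- vanishes; both `gb-factorial` and `gb-N` come from it.
  gb-ratio : ∀ n k → (1# - Q (+ suc k)) * gb n (suc k) ≈ (1# - Q (+ n ℤ.- + k)) * gb n k
  gb-ratio zero    zero    =
    solve 1 (λ x → (con (+ 1) :- x) :* con (+ 0) := (con (+ 1) :- con (+ 1)) :* con (+ 1)) refl _
  gb-ratio zero    (suc k) = trans (zeroʳ _) (sym (zeroʳ _))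
  gb-ratio (suc n) zero    = begin
    (1# - Q (+ 1)) * (1# + Q (+ 1) * gb n 1)
      ≈⟨ solve 2 (λ x g → (con (+ 1) :- x) :* (con (+ 1) :+ x :* g)
                       := con (+ 1) :- x :+ x :* ((con (+ 1) :- x) :* g)) refl _ _ ⟩
    1# - Q (+ 1) + Q (+ 1) * ((1# - Q (+ 1)) * gb n 1)
      ≈⟨ +-congˡ (*-congˡ (gb-ratio n 0)) ⟩
    1# - Q (+ 1) + Q (+ 1) * ((1# - Q (+ n ℤ.- + 0)) * 1#)
      ≈⟨ solve 2 (λ x y → con (+ 1) :- x :+ x :* ((con (+ 1) :- y) :* con (+ 1))
                       := (con (+ 1) :- x :* y) :* con (+ 1)) refl _ _ ⟩
    (1# - Q (+ 1) * Q (+ n ℤ.- + 0)) * 1#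
      ≈⟨ *-congʳ (+-congˡ (-‿cong (Q-*-≡ (+ 1) (+ n ℤ.- + 0) (eq (+ n))))) ⟩
    (1# - Q (+ suc n ℤ.- + 0)) * 1# ∎
    where
      eq : ∀ n → + 1 ℤ.+ (n ℤ.- + 0) ≡ + 1 ℤ.+ n ℤ.- + 0
      eq = solve-∀
  gb-ratio (suc n) (suc k) = begin
    (1# - Q (+ suc (suc k))) * (g₁ + Q (+ suc (suc k)) * g₂)
      ≈⟨ solve 3 (λ x a b → (con (+ 1) :- x) :* (a :+ x :* b)
                         := (con (+ 1) :- x) :* a :+ x :* ((con (+ 1) :- x) :* b)) refl _ _ _ ⟩
    (1# - Q (+ suc (suc k))) * g₁ + Q (+ suc (suc k)) * ((1# - Q (+ suc (suc k))) * g₂)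
      ≈⟨ +-congˡ (*-congˡ (gb-ratio n (suc k))) ⟩
    (1# - Q (+ suc (suc k))) * g₁ + Q (+ suc (suc k)) * ((1# - Q (+ n ℤ.- + suc k)) * g₁)
      ≈⟨ solve 3 (λ x y a → (con (+ 1) :- x) :* a :+ x :* ((con (+ 1) :- y) :* a)
                         := (con (+ 1) :- x :* y) :* a) refl _ _ _ ⟩
    (1# - Q (+ suc (suc k)) * Q (+ n ℤ.- + suc k)) * g₁
      ≈⟨ *-congʳ (+-congˡ (-‿cong (trans (Q-*-≡ (+ suc (suc k)) (+ n ℤ.- + suc k) (eq (+ n) (+ k))) (Q-+ (+ suc k) (+ n ℤ.- + k))))) ⟩
    (1# - Q (+ suc k) * Q (+ n ℤ.- + k)) * g₁
      ≈⟨ solve 3 (λ x y a → (con (+ 1) :- x :* y) :* a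
                         := (con (+ 1) :- y) :* (x :* a) :+ (con (+ 1) :- x) :* a) refl _ _ _ ⟩
    (1# - Q (+ n ℤ.- + k)) * (Q (+ suc k) * g₁) + (1# - Q (+ suc k)) * g₁
      ≈⟨ +-congˡ (gb-ratio n k) ⟩
    (1# - Q (+ n ℤ.- + k)) * (Q (+ suc k) * g₁) + (1# - Q (+ n ℤ.- + k)) * g₀
      ≈⟨ solve 3 (λ y a b → y :* a :+ y :* b := y :* (b :+ a)) refl _ _ _ ⟩
    (1# - Q (+ n ℤ.- + k)) * (g₀ + Q (+ suc k) * g₁)
      ≈⟨ *-congʳ (+-congˡ (-‿cong (Q-≡ (eq′ (+ n) (+ k))))) ⟩
    (1# - Q (+ suc n ℤ.- + suc k)) * (g₀ + Q (+ suc k) * g₁) ∎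
    where
      g₀ = gb n k
      g₁ = gb n (suc k)
      g₂ = gb n (suc (suc k))
      eq : ∀ n k → + 2 ℤ.+ k ℤ.+ (n ℤ.- (+ 1 ℤ.+ k)) ≡ + 1 ℤ.+ k ℤ.+ (n ℤ.- k)
      eq = solve-∀
      eq′ : ∀ n k → n ℤ.- k ≡ + 1 ℤ.+ n ℤ.- (+ 1 ℤ.+ k)
      eq′ = solve-∀

  q! : ℕ → Carrier
  q! = poch F q q

  -- `gb-ratio` moves one factor from the first factorial to the second, so the induction lowers k
  -- while j grows and ends at lower index 0.
  gb-factorial : ∀ k j → q! k * q! j * gb (k ℕ.+ j) k ≈ q! (k ℕ.+ j)
  gb-factorial zero    j = solve 1 (λ x → con (+ 1) :* x :* con (+ 1) := x) refl _
  gb-factorial (suc k) j = begin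
    q! k * (1# - Q (+ suc k)) * q! j * gb n (suc k)
      ≈⟨ solve 4 (λ a b c d → a :* b :* c :* d := a :* c :* (b :* d)) refl _ _ _ _ ⟩
    q! k * q! j * ((1# - Q (+ suc k)) * gb n (suc k))
      ≈⟨ *-congˡ (gb-ratio n k) ⟩
    q! k * q! j * ((1# - Q (+ n ℤ.- + k)) * gb n k)
      ≈⟨ *-congˡ (*-congʳ (+-congˡ (-‿cong (Q-≡ (eq (+ k) (+ j)))))) ⟩
    q! k * q! j * ((1# - Q (+ suc j)) * gb n k)
      ≈⟨ solve 4 (λ a b c d → a :* b :* (c :* d) := a :* (b :* c) :* d) refl _ _ _ _ ⟩
    q! k * q! (suc j) * gb n k
      ≡⟨ ≡.cong (λ n → q! k * q! (suc j) * gb n k) (ℕₚ.+-suc k j) ⟨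
    q! k * q! (suc j) * gb (k ℕ.+ suc j) k
      ≈⟨ gb-factorial k (suc j) ⟩
    q! (k ℕ.+ suc j)
      ≡⟨ ≡.cong q! (ℕₚ.+-suc k j) ⟩
    q! n ∎
    where
      n = suc k ℕ.+ j
      eq : ∀ k j → + 1 ℤ.+ k ℤ.+ j ℤ.- k ≡ + 1 ℤ.+ j
      eq = solve-∀

  -- Sums weighted by a row of Gaussian binomials.

  -- S n f = ∑ₖ [n k] f k (see S-gb).  Defined by recursion, it makes both q-Pascal
  -- rules and the symmetry of [n k] pointwise identities on f.
  S : ℕ → (ℕ → Carrier) → Carrier
  pascal : (ℕ → Carrier) → ℕ → Carrier
  pascal f k = f (suc k) + Q (+ k) * f k
  S zero    f = f 0
  S (suc n) f = S n (pascal f)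

  S-cong : ∀ n {f g} → (∀ k → f k ≈ g k) → S n f ≈ S n g
  S-cong zero    e = e 0
  S-cong (suc n) e = S-cong n (λ k → +-cong (e (suc k)) (*-congˡ (e k)))

  S-+ : ∀ n f g → S n (λ k → f k + g k) ≈ S n f + S n g
  S-+ zero    f g = refl
  S-+ (suc n) f g = trans
    (S-cong n (λ k → solve 5 (λ a b x c d → a :+ b :+ x :* (c :+ d) := a :+ x :* c :+ (b :+ x :* d))
                             refl _ _ _ _ _))
    (S-+ n (pascal f) (pascal g))

  S-* : ∀ x n f → S n (λ k → x * f k) ≈ x * S n f
  S-* x zero    f = refl
  S-* x (suc n) f = trans
    (S-cong n (λ k → solve 4 (λ x a y b → x :* a :+ y :* (x :* b) := x :* (a :+ y :* b)) refl _ _ _ _))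
    (S-* x n (pascal f))

  S-neg : ∀ n f → S n (λ k → - f k) ≈ - S n f
  S-neg n f = begin
    S n (λ k → - f k)         ≈⟨ S-cong n (λ k → neg (f k)) ⟩
    S n (λ k → - 1# * f k)    ≈⟨ S-* (- 1#) n f ⟩
    - 1# * S n f              ≈⟨ neg _ ⟨
    - S n f                   ∎
    where
      neg : ∀ x → - x ≈ - 1# * x
      neg = solve 1 (λ x → :- x := :- con (+ 1) :* x) refl

  S-gb : ∀ n f → S n f ≈ ∑ (suc n) (λ k → gb n k * f k)
  S-gb zero    f = sym (trans (+-identityˡ _) (*-identityˡ _))
  S-gb (suc n) f = begin
    S n (pascal f)
      ≈⟨ S-gb n (pascal f) ⟩
    ∑ (suc n) (λ k → gb n k * (f (suc k) + Q (+ k) * f k))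
      ≈⟨ ∑-cong (suc n) (λ k → solve 4 (λ g a x b → g :* (a :+ x :* b) := g :* a :+ x :* g :* b) refl _ _ _ _) ⟩
    ∑ (suc n) (λ k → gb n k * f (suc k) + h k)
      ≈⟨ ∑-+ (suc n) _ _ ⟩
    ∑ (suc n) (λ k → gb n k * f (suc k)) + ∑ (suc n) h
      ≈⟨ +-congˡ (+-identityʳ _) ⟨
    ∑ (suc n) (λ k → gb n k * f (suc k)) + (∑ (suc n) h + 0#)
      ≈⟨ +-congˡ (+-congˡ last) ⟨
    ∑ (suc n) (λ k → gb n k * f (suc k)) + ∑ (suc (suc n)) h
      ≈⟨ +-congˡ (∑-head (suc n) h) ⟩
    ∑ (suc n) (λ k → gb n k * f (suc k)) + (h 0 + ∑ (suc n) (λ k → h (suc k)))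
      ≈⟨ solve 3 (λ a b c → a :+ (b :+ c) := b :+ (a :+ c)) refl _ _ _ ⟩
    h 0 + (∑ (suc n) (λ k → gb n k * f (suc k)) + ∑ (suc n) (λ k → h (suc k)))
      ≈⟨ +-cong (*-congʳ (*-identityˡ 1#)) (sym (∑-+ (suc n) _ _)) ⟩
    1# * f 0 + ∑ (suc n) (λ k → gb n k * f (suc k) + h (suc k))
      ≈⟨ +-congˡ (∑-cong (suc n) (λ k → distribʳ (f (suc k)) _ _)) ⟨
    1# * f 0 + ∑ (suc n) (λ k → gb (suc n) (suc k) * f (suc k))
      ≈⟨ ∑-head (suc n) _ ⟨
    ∑ (suc (suc n)) (λ k → gb (suc n) k * f k) ∎
    where
      h : ℕ → Carrier
      h k = Q (+ k) * gb n k * f k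
      last : h (suc n) ≈ 0#
      last = trans (*-congʳ (trans (*-congˡ (gb-> n (suc n) ℕₚ.≤-refl)) (zeroʳ _))) (zeroˡ _)

  pascal′ : ℕ → (ℕ → Carrier) → ℕ → Carrier
  pascal′ n f k = f k + Q (+ n ℤ.- + k) * f (suc k)

  -- The two Pascal steps commute, since their cross coefficients q^(n-k) q^(k+1) and q^k q^(n+1-k)
  -- agree; the second rule then follows from the first by induction.
  S-pascal′ : ∀ n f → S (suc n) f ≈ S n (pascal′ n f)
  S-pascal′ zero    f =
    solve 2 (λ a b → a :+ con (+ 1) :* b := b :+ con (+ 1) :* a) refl _ _
  S-pascal′ (suc n) f = begin
    S (suc n) (pascal f)               ≈⟨ S-pascal′ n (pascal f) ⟩
    S n (pascal′ n (pascal f))         ≈⟨ S-cong n commute ⟩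
    S n (pascal (pascal′ (suc n) f))   ∎
    where
      eq₁ : ∀ n k → n ℤ.- k ℤ.+ (+ 1 ℤ.+ k) ≡ k ℤ.+ (+ 1 ℤ.+ n ℤ.- k)
      eq₁ = solve-∀
      eq₂ : ∀ n k → n ℤ.- k ≡ + 1 ℤ.+ n ℤ.- (+ 1 ℤ.+ k)
      eq₂ = solve-∀
      commute : ∀ k → pascal′ n (pascal f) k ≈ pascal (pascal′ (suc n) f) k
      commute k = begin
        f₁ + x * f₀ + y * (f₂ + Q (+ suc k) * f₁)
          ≈⟨ solve 6 (λ f₀ f₁ f₂ x y z → f₁ :+ x :* f₀ :+ y :* (f₂ :+ z :* f₁)
                                      := f₁ :+ y :* f₂ :+ (x :* f₀ :+ y :* z :* f₁)) refl _ _ _ _ _ _ ⟩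
        f₁ + y * f₂ + (x * f₀ + y * Q (+ suc k) * f₁)
          ≈⟨ +-cong (+-congˡ (*-congʳ (Q-≡ (eq₂ (+ n) (+ k)))))
                    (+-congˡ (*-congʳ (trans (Q-*-≡ (+ n ℤ.- + k) (+ suc k) (eq₁ (+ n) (+ k))) (Q-+ (+ k) (+ suc n ℤ.- + k))))) ⟩
        f₁ + Q (+ suc n ℤ.- + suc k) * f₂ + (x * f₀ + x * Q (+ suc n ℤ.- + k) * f₁)
          ≈⟨ +-congˡ (solve 4 (λ x a y b → x :* a :+ x :* y :* b := x :* (a :+ y :* b)) refl _ _ _ _) ⟩
        pascal (pascal′ (suc n) f) k ∎
        where
          f₀ = f k
          f₁ = f (suc k)
          f₂ = f (suc (suc k))
          x  = Q (+ k)
          y  = Q (+ n ℤ.- + k)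

  -- Reversal exchanges the two Pascal rules. The function lives on ℤ because `S-cong` compares at
  -- every k, also where n - k is negative.
  S-reflect : ∀ n (f : ℤ → Carrier) → S n (λ k → f (+ k)) ≈ S n (λ k → f (+ n ℤ.- + k))
  S-reflect zero    f = refl
  S-reflect (suc n) f = begin
    S n (λ k → f (+ suc k) + Q (+ k) * f (+ k))
      ≈⟨ S-reflect n (λ i → f (+ 1 ℤ.+ i) + Q i * f i) ⟩
    S n (λ k → f (+ 1 ℤ.+ (+ n ℤ.- + k)) + Q (+ n ℤ.- + k) * f (+ n ℤ.- + k))
      ≈⟨ S-cong n (λ k → +-cong (f-≡ (eq₁ (+ n) (+ k))) (*-congˡ (f-≡ (eq₂ (+ n) (+ k))))) ⟩
    S n (pascal′ n (λ k → f (+ suc n ℤ.- + k)))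
      ≈⟨ S-pascal′ n (λ k → f (+ suc n ℤ.- + k)) ⟨
    S (suc n) (λ k → f (+ suc n ℤ.- + k)) ∎
    where
      f-≡ : ∀ {i j} → i ≡ j → f i ≈ f j
      f-≡ e = reflexive (≡.cong f e)
      eq₁ : ∀ n k → + 1 ℤ.+ (n ℤ.- k) ≡ + 1 ℤ.+ n ℤ.- k
      eq₁ = solve-∀
      eq₂ : ∀ n k → n ℤ.- k ≡ + 1 ℤ.+ n ℤ.- (+ 1 ℤ.+ k)
      eq₂ = solve-∀

  S-antisymmetric : ∀ n (f : ℤ → Carrier) → (∀ i → f (+ n ℤ.- i) ≈ - f i) → S n (λ k → f (+ k)) ≈ 0#
  S-antisymmetric n f anti = x≈-x⇒x≈0 (begin
    S n (λ k → f (+ k))             ≈⟨ S-reflect n f ⟩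
    S n (λ k → f (+ n ℤ.- + k))     ≈⟨ S-cong n (λ k → anti (+ k)) ⟩
    S n (λ k → - f (+ k))           ≈⟨ S-neg n (λ k → f (+ k)) ⟩
    - S n (λ k → f (+ k))           ∎)

  -- The q-Chu-Vandermonde sum.

  -- g M i = (-1)ⁱ q^(i(i+1)/2 - M i)
  g : ℕ → ℕ → Carrier
  g M zero    = 1#
  g M (suc i) = - (Q (+ suc i ℤ.- + M) * g M i)

  g-suc : ∀ M i → g (suc M) i ≈ Q (ℤ.- + i) * g M i
  g-suc M zero    = sym (*-identityˡ 1#)
  g-suc M (suc i) = begin
    - (Q (+ suc i ℤ.- + suc M) * g (suc M) i)
      ≈⟨ -‿cong (*-congˡ (g-suc M i)) ⟩
    - (Q (+ suc i ℤ.- + suc M) * (Q (ℤ.- + i) * g M i))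
      ≈⟨ -‿cong (sym (*-assoc _ _ _)) ⟩
    - (Q (+ suc i ℤ.- + suc M) * Q (ℤ.- + i) * g M i)
      ≈⟨ -‿cong (*-congʳ (trans (Q-*-≡ (+ suc i ℤ.- + suc M) (ℤ.- + i) (eq (+ i) (+ M))) (Q-+ (ℤ.- + suc i) (+ suc i ℤ.- + M)))) ⟩
    - (Q (ℤ.- + suc i) * Q (+ suc i ℤ.- + M) * g M i)
      ≈⟨ solve 3 (λ x y z → :- (x :* y :* z) := x :* :- (y :* z)) refl _ _ _ ⟩
    Q (ℤ.- + suc i) * g M (suc i) ∎
    where
      eq : ∀ i M → + 1 ℤ.+ i ℤ.- (+ 1 ℤ.+ M) ℤ.+ ℤ.- i ≡ ℤ.- (+ 1 ℤ.+ i) ℤ.+ (+ 1 ℤ.+ i ℤ.- M)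
      eq = solve-∀

  g-+ : ∀ M n i → g (n ℕ.+ M) (n ℕ.+ i) ≈ g (n ℕ.+ M) n * g M i
  g-+ M n zero    rewrite ℕₚ.+-identityʳ n = sym (*-identityʳ _)
  g-+ M n (suc i) rewrite ℕₚ.+-suc n i = begin
    - (Q (+ suc (n ℕ.+ i) ℤ.- + (n ℕ.+ M)) * g (n ℕ.+ M) (n ℕ.+ i))
      ≈⟨ -‿cong (*-cong (Q-≡ (eq (+ i) (+ M) (+ n))) (g-+ M n i)) ⟩
    - (Q (+ suc i ℤ.- + M) * (g (n ℕ.+ M) n * g M i))
      ≈⟨ solve 3 (λ x y z → :- (x :* (y :* z)) := y :* :- (x :* z)) refl _ _ _ ⟩
    g (n ℕ.+ M) n * g M (suc i) ∎
    where
      eq : ∀ i M n → + 1 ℤ.+ (n ℤ.+ i) ℤ.- (n ℤ.+ M) ≡ + 1 ℤ.+ i ℤ.- M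
      eq = solve-∀

  -- The q-Chu-Vandermonde sum ₂φ₁(b, q⁻ᴹ; 0; q, q).
  vandermonde : ∀ M b → S M (λ i → g M i * poch F q b i) ≈ pow F b M
  vandermonde zero    b = *-identityˡ 1#
  vandermonde (suc M) b = begin
    S (suc M) f
      ≈⟨ S-pascal′ M f ⟩
    S M (pascal′ M f)
      ≈⟨ S-cong M step ⟩
    S M (λ i → b * (g M i * poch F q b i))
      ≈⟨ S-* b M _ ⟩
    b * S M (λ i → g M i * poch F q b i)
      ≈⟨ *-congˡ (vandermonde M b) ⟩
    b * pow F b M ∎
    where
      f : ℕ → Carrier
      f i = g (suc M) i * poch F q b i
      eq : ∀ i M → M ℤ.- i ℤ.+ (+ 1 ℤ.+ i ℤ.- (+ 1 ℤ.+ M)) ≡ + 0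
      eq = solve-∀
      -- The coefficient q^(M-i) of the second Pascal rule cancels the factor that `g` gains at i +
      -- 1. What remains is 1 - (1 - b qⁱ) = b qⁱ, and `g-suc` absorbs the qⁱ.
      step : ∀ i → pascal′ M f i ≈ b * (g M i * poch F q b i)
      step i = begin
        G * p + Q (+ M ℤ.- + i) * (- (Q (+ suc i ℤ.- + suc M) * G) * (p * (1# - b * Q (+ i))))
          ≈⟨ solve 6 (λ G p y z b x → G :* p :+ y :* (:- (z :* G) :* (p :* (con (+ 1) :- b :* x)))
                       := G :* p :- y :* z :* (G :* p :* (con (+ 1) :- b :* x))) refl _ _ _ _ _ _ ⟩
        G * p - Q (+ M ℤ.- + i) * Q (+ suc i ℤ.- + suc M) * (G * p * (1# - b * Q (+ i)))
          ≈⟨ +-congˡ (-‿cong (*-congʳ (Q-*-≡ (+ M ℤ.- + i) (+ suc i ℤ.- + suc M) (eq (+ i) (+ M))))) ⟩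
        G * p - 1# * (G * p * (1# - b * Q (+ i)))
          ≈⟨ solve 4 (λ G p b x → G :* p :- con (+ 1) :* (G :* p :* (con (+ 1) :- b :* x))
                       := b :* (x :* G :* p)) refl _ _ _ _ ⟩
        b * (Q (+ i) * G * p)
          ≈⟨ *-congˡ (*-congʳ (*-congˡ (g-suc M i))) ⟩
        b * (Q (+ i) * (Q (ℤ.- + i) * g M i) * p)
          ≈⟨ solve 5 (λ b x y h p → b :* (x :* (y :* h) :* p) := b :* (x :* y :* h :* p)) refl _ _ _ _ _ ⟩
        b * (Q (+ i) * Q (ℤ.- + i) * g M i * p)
          ≈⟨ *-congˡ (*-congʳ (trans (*-congʳ (Q-inverse (+ i))) (*-identityˡ _))) ⟩
        b * (g M i * p) ∎
        where
          G = g (suc M) i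
          p = poch F q b i

-- The sequence X, its two reflections and its two binomial sums.

module FalseTheta {c ℓ} (F : Field0 c ℓ) (q : Field0.Carrier F)
                  (q≉0 : ¬ (Field0._≈_ F q (Field0.0# F))) where
  open Field0 F
  open import Relation.Binary.Reasoning.Setoid setoid
  open FieldArithmetic F
  open QCalculus F q q≉0

  X⁺ : ℕ → Carrier
  X⁺ 0 = 1#
  X⁺ 1 = 0#
  X⁺ 2 = - Q (+ 2)
  X⁺ (suc (suc (suc n))) = Q (+ 4 ℤ.* + n ℤ.+ + 5) * X⁺ n

  -- X m = χ(m) q^(m(2m-1)/3) with χ(m) = 1, 0, -1 for m ≡ 0, 1, 2 (mod 3).
  X : ℤ → Carrier
  X (+ n)    = X⁺ n
  X -[1+ n ] = - (Q (+ n ℤ.+ + n ℤ.+ + 1) * X⁺ n)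

  X-≡ : ∀ {i j} → i ≡ j → X i ≈ X j
  X-≡ e = reflexive (≡.cong X e)

  private
    swap-neg : ∀ {x y} → x ≈ - y → y ≈ - x
    swap-neg e = trans (sym (-‿involutive _)) (-‿cong (sym e))

    solve-for : ∀ {t u v} → t ℤ.+ u ≡ v → u ≡ v ℤ.- t
    solve-for {t} {u} ≡.refl = eq t u
      where
        eq : ∀ t u → u ≡ t ℤ.+ u ℤ.- t
        eq = solve-∀

  -- The exponent of qᵐ X m is 2m(m+1)/3, invariant under m ↦ -1-m, while χ changes sign. The
  -- negative half of `X` is defined by this very rule.
  QX-reflect-1 : ∀ t u → t ℤ.+ u ≡ ℤ.- + 1 → Q u * X u ≈ - (Q t * X t)
  QX-reflect-1 (+ n) u e = begin
    Q u * X u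
      ≈⟨ *-cong (Q-≡ u≡) (X-≡ u≡) ⟩
    Q -[1+ n ] * - (Q (+ n ℤ.+ + n ℤ.+ + 1) * X⁺ n)
      ≈⟨ solve 3 (λ x y z → x :* :- (y :* z) := :- (x :* y :* z)) refl _ _ _ ⟩
    - (Q -[1+ n ] * Q (+ n ℤ.+ + n ℤ.+ + 1) * X⁺ n)
      ≈⟨ -‿cong (*-congʳ (Q-*-≡ -[1+ n ] (+ n ℤ.+ + n ℤ.+ + 1) (eq (+ n)))) ⟩
    - (Q (+ n) * X⁺ n) ∎
    where
      eq : ∀ n → ℤ.- (+ 1 ℤ.+ n) ℤ.+ (n ℤ.+ n ℤ.+ + 1) ≡ n
      eq = solve-∀
      eq′ : ∀ n → ℤ.- + 1 ℤ.- n ≡ ℤ.- (+ 1 ℤ.+ n)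
      eq′ = solve-∀
      u≡ : u ≡ -[1+ n ]
      u≡ = ≡.trans (solve-for {+ n} e) (eq′ (+ n))
  QX-reflect-1 -[1+ n ] u e = begin
    Q u * X u              ≈⟨ *-cong (Q-≡ u≡) (X-≡ u≡) ⟩
    Q (+ n) * X (+ n)      ≈⟨ swap-neg (QX-reflect-1 (+ n) -[1+ n ] (eq (+ n))) ⟩
    - (Q -[1+ n ] * X -[1+ n ]) ∎
    where
      eq : ∀ n → n ℤ.+ ℤ.- (+ 1 ℤ.+ n) ≡ ℤ.- + 1
      eq = solve-∀
      eq′ : ∀ n → ℤ.- + 1 ℤ.- ℤ.- (+ 1 ℤ.+ n) ≡ n
      eq′ = solve-∀
      u≡ : u ≡ + n
      u≡ = ≡.trans (solve-for { -[1+ n ]} e) (eq′ (+ n))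

  private
    reflect-2-0 : Q (ℤ.- + 2) * X (+ 2) ≈ - (Q (ℤ.- + 0) * X (+ 0))
    reflect-2-0 = begin
      Q (ℤ.- + 2) * - Q (+ 2)
        ≈⟨ solve 2 (λ x y → x :* :- y := :- (x :* y)) refl _ _ ⟩
      - (Q (ℤ.- + 2) * Q (+ 2))
        ≈⟨ -‿cong (Q-*-≡ (ℤ.- + 2) (+ 2) ≡.refl) ⟩
      - 1#
        ≈⟨ -‿cong (*-identityˡ 1#) ⟨
      - (1# * 1#) ∎

    reflect-2-neg : ∀ n → Q (ℤ.- -[1+ n ]) * X -[1+ n ]
                        ≈ - (Q (ℤ.- + suc (suc (suc n))) * X (+ suc (suc (suc n))))
    reflect-2-neg n = begin
      Q (+ suc n) * - (Q (+ n ℤ.+ + n ℤ.+ + 1) * X⁺ n)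
        ≈⟨ solve 3 (λ x y z → x :* :- (y :* z) := :- (x :* y :* z)) refl _ _ _ ⟩
      - (Q (+ suc n) * Q (+ n ℤ.+ + n ℤ.+ + 1) * X⁺ n)
        ≈⟨ -‿cong (*-congʳ (trans (Q-*-≡ (+ suc n) (+ n ℤ.+ + n ℤ.+ + 1) (eq (+ n)))
                                  (Q-+ (ℤ.- + suc (suc (suc n))) (+ 4 ℤ.* + n ℤ.+ + 5)))) ⟩
      - (Q (ℤ.- + suc (suc (suc n))) * Q (+ 4 ℤ.* + n ℤ.+ + 5) * X⁺ n)
        ≈⟨ -‿cong (*-assoc _ _ _) ⟩
      - (Q (ℤ.- + suc (suc (suc n))) * X⁺ (suc (suc (suc n)))) ∎
      where
        eq : ∀ n → + 1 ℤ.+ n ℤ.+ (n ℤ.+ n ℤ.+ + 1) ≡ ℤ.- (+ 3 ℤ.+ n) ℤ.+ (+ 4 ℤ.* n ℤ.+ + 5)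
        eq = solve-∀

  -- The exponent of q⁻ᵐ X m is 2m(m-2)/3, invariant under m ↦ 2-m. Combined with the first
  -- reflection this is the shift by 3, so the recursion of `X⁺` settles every t outside 0, 1, 2.
  QX-reflect-2 : ∀ t u → t ℤ.+ u ≡ + 2 → Q (ℤ.- u) * X u ≈ - (Q (ℤ.- t) * X t)
  QX-reflect-2 t u e = trans (*-cong (Q-≡ (≡.cong ℤ.-_ u≡)) (X-≡ u≡)) (aux t)
    where
      u≡ : u ≡ + 2 ℤ.- t
      u≡ = solve-for {t} e
      eq : ∀ n → + 2 ℤ.- (+ 3 ℤ.+ n) ≡ ℤ.- (+ 1 ℤ.+ n)
      eq = solve-∀
      aux : ∀ t → Q (ℤ.- (+ 2 ℤ.- t)) * X (+ 2 ℤ.- t) ≈ - (Q (ℤ.- t) * X t)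
      aux (+ 0) = reflect-2-0
      aux (+ 1) = solve 1 (λ x → x :* con (+ 0) := :- (x :* con (+ 0))) refl _
      aux (+ 2) = swap-neg reflect-2-0
      aux (+ suc (suc (suc n))) = trans
        (*-cong (Q-≡ (≡.cong ℤ.-_ (eq (+ n)))) (X-≡ (eq (+ n)))) (reflect-2-neg n)
      aux -[1+ n ] = swap-neg (reflect-2-neg n)

  private
    -- Reversing row 2ν+1 sends m = ν-k to -1-m: the first reflection.
    odd-vanish : ∀ ν → S (suc (ν ℕ.+ ν)) (λ k → Q (+ ν ℤ.- + k) * X (+ ν ℤ.- + k)) ≈ 0#
    odd-vanish ν = S-antisymmetric (suc (ν ℕ.+ ν)) (λ i → Q (+ ν ℤ.- i) * X (+ ν ℤ.- i))
      (λ i → QX-reflect-1 (+ ν ℤ.- i) (+ ν ℤ.- (+ suc (ν ℕ.+ ν) ℤ.- i)) (eq (+ ν) i))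
      where
        eq : ∀ ν i → ν ℤ.- i ℤ.+ (ν ℤ.- (+ 1 ℤ.+ (ν ℤ.+ ν) ℤ.- i)) ≡ ℤ.- + 1
        eq = solve-∀

    -- Reversing row 2ν sends m = ν+1-k to 2-m: the second reflection.
    even-vanish : ∀ ν → S (ν ℕ.+ ν) (λ k → Q (ℤ.- (+ suc ν ℤ.- + k)) * X (+ suc ν ℤ.- + k)) ≈ 0#
    even-vanish ν = S-antisymmetric (ν ℕ.+ ν) (λ i → Q (ℤ.- (+ suc ν ℤ.- i)) * X (+ suc ν ℤ.- i))
      (λ i → QX-reflect-2 (+ suc ν ℤ.- i) (+ suc ν ℤ.- (+ (ν ℕ.+ ν) ℤ.- i)) (eq (+ ν) i))
      where
        eq : ∀ ν i → + 1 ℤ.+ ν ℤ.- i ℤ.+ (+ 1 ℤ.+ ν ℤ.- (ν ℤ.+ ν ℤ.- i)) ≡ + 2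
        eq = solve-∀

    eq₀ : ∀ ν k → + 1 ℤ.+ ν ℤ.- (+ 1 ℤ.+ k) ≡ ν ℤ.- k
    eq₀ = solve-∀

  -- By the second Pascal rule: its coefficient q^(2ν+1-k) is q^(ν+1) q^(ν-k), so the extra part is
  -- a multiple of `odd-vanish`.
  S-X-even→odd : ∀ ν → S (suc (suc (ν ℕ.+ ν))) (λ k → X (+ suc ν ℤ.- + k))
                      ≈ S (suc (ν ℕ.+ ν)) (λ k → X (+ suc ν ℤ.- + k))
  S-X-even→odd ν = begin
    S (suc n) f
      ≈⟨ S-pascal′ n f ⟩
    S n (λ k → f k + Q (+ n ℤ.- + k) * f (suc k))
      ≈⟨ S-cong n (λ k → +-congˡ (term k)) ⟩
    S n (λ k → f k + Q (+ suc ν) * (Q (+ ν ℤ.- + k) * X (+ ν ℤ.- + k)))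
      ≈⟨ S-+ n f _ ⟩
    S n f + S n (λ k → Q (+ suc ν) * (Q (+ ν ℤ.- + k) * X (+ ν ℤ.- + k)))
      ≈⟨ +-congˡ (trans (S-* (Q (+ suc ν)) n _) (trans (*-congˡ (odd-vanish ν)) (zeroʳ _))) ⟩
    S n f + 0#
      ≈⟨ +-identityʳ _ ⟩
    S n f ∎
    where
      n = suc (ν ℕ.+ ν)
      f : ℕ → Carrier
      f k = X (+ suc ν ℤ.- + k)
      eq : ∀ ν k → + 1 ℤ.+ (ν ℤ.+ ν) ℤ.- k ≡ + 1 ℤ.+ ν ℤ.+ (ν ℤ.- k)
      eq = solve-∀
      term : ∀ k → Q (+ n ℤ.- + k) * f (suc k) ≈ Q (+ suc ν) * (Q (+ ν ℤ.- + k) * X (+ ν ℤ.- + k))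
      term k = trans
        (*-cong (trans (Q-≡ (eq (+ ν) (+ k))) (Q-+ (+ suc ν) (+ ν ℤ.- + k))) (X-≡ (eq₀ (+ ν) (+ k))))
        (*-assoc _ _ _)

  -- By the first Pascal rule: its coefficient q^k is q^(ν+1) q^(-(ν+1-k)), so the extra part is a
  -- multiple of `even-vanish`.
  S-X-odd→even : ∀ ν → S (suc (ν ℕ.+ ν)) (λ k → X (+ suc ν ℤ.- + k))
                      ≈ S (ν ℕ.+ ν) (λ k → X (+ ν ℤ.- + k))
  S-X-odd→even ν = begin
    S n (λ k → X (+ suc ν ℤ.- + suc k) + Q (+ k) * X (+ suc ν ℤ.- + k))
      ≈⟨ S-cong n (λ k → +-cong (X-≡ (eq₀ (+ ν) (+ k))) (term k)) ⟩
    S n (λ k → X (+ ν ℤ.- + k) + Q (+ suc ν) * (Q (ℤ.- (+ suc ν ℤ.- + k)) * X (+ suc ν ℤ.- + k)))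
      ≈⟨ S-+ n _ _ ⟩
    S n (λ k → X (+ ν ℤ.- + k)) + S n (λ k → Q (+ suc ν) * (Q (ℤ.- (+ suc ν ℤ.- + k)) * X (+ suc ν ℤ.- + k)))
      ≈⟨ +-congˡ (trans (S-* (Q (+ suc ν)) n _) (trans (*-congˡ (even-vanish ν)) (zeroʳ _))) ⟩
    S n (λ k → X (+ ν ℤ.- + k)) + 0#
      ≈⟨ +-identityʳ _ ⟩
    S n (λ k → X (+ ν ℤ.- + k)) ∎
    where
      n = ν ℕ.+ ν
      eq : ∀ ν k → k ≡ + 1 ℤ.+ ν ℤ.+ ℤ.- (+ 1 ℤ.+ ν ℤ.- k)
      eq = solve-∀
      term : ∀ k → Q (+ k) * X (+ suc ν ℤ.- + k)
                 ≈ Q (+ suc ν) * (Q (ℤ.- (+ suc ν ℤ.- + k)) * X (+ suc ν ℤ.- + k))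
      term k = trans
        (*-congʳ (trans (Q-≡ (eq (+ ν) (+ k))) (Q-+ (+ suc ν) (ℤ.- (+ suc ν ℤ.- + k)))))
        (*-assoc _ _ _)

  S-X : ∀ ν → S (ν ℕ.+ ν) (λ k → X (+ ν ℤ.- + k)) ≈ 1#
  S-X zero = refl
  S-X (suc ν) rewrite ℕₚ.+-suc ν ν =
    trans (S-X-even→odd ν) (trans (S-X-odd→even ν) (S-X ν))

  -- The first Pascal rule splits off `odd-vanish`; in the other part q^k q^(ν+1-k) is the constant
  -- q^(ν+1), which leaves a sum already known to be 1.
  S-QX : ∀ ν → S (ν ℕ.+ ν) (λ k → Q (+ ν ℤ.- + k) * X (+ ν ℤ.- + k)) ≈ Q (+ ν)
  S-QX zero = *-identityˡ 1#
  S-QX (suc ν) rewrite ℕₚ.+-suc ν ν = begin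
    S n (pascal (λ k → Q (+ suc ν ℤ.- + k) * X (+ suc ν ℤ.- + k)))
      ≈⟨ S-cong n (λ k → +-cong (*-cong (Q-≡ (eq₀ (+ ν) (+ k))) (X-≡ (eq₀ (+ ν) (+ k)))) (term k)) ⟩
    S n (λ k → Q (+ ν ℤ.- + k) * X (+ ν ℤ.- + k) + Q (+ suc ν) * X (+ suc ν ℤ.- + k))
      ≈⟨ S-+ n _ _ ⟩
    S n (λ k → Q (+ ν ℤ.- + k) * X (+ ν ℤ.- + k)) + S n (λ k → Q (+ suc ν) * X (+ suc ν ℤ.- + k))
      ≈⟨ +-cong (odd-vanish ν) (S-* (Q (+ suc ν)) n _) ⟩
    0# + Q (+ suc ν) * S n (λ k → X (+ suc ν ℤ.- + k))
      ≈⟨ trans (+-identityˡ _) (*-congˡ (trans (S-X-odd→even ν) (S-X ν))) ⟩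
    Q (+ suc ν) * 1#
      ≈⟨ *-identityʳ _ ⟩
    Q (+ suc ν) ∎
    where
      n = suc (ν ℕ.+ ν)
      eq : ∀ ν k → k ℤ.+ (+ 1 ℤ.+ ν ℤ.- k) ≡ + 1 ℤ.+ ν
      eq = solve-∀
      term : ∀ k → Q (+ k) * (Q (+ suc ν ℤ.- + k) * X (+ suc ν ℤ.- + k))
                 ≈ Q (+ suc ν) * X (+ suc ν ℤ.- + k)
      term k = trans (sym (*-assoc _ _ _)) (*-congʳ (Q-*-≡ (+ k) (+ suc ν ℤ.- + k) (eq (+ ν) (+ k))))

  -- The sequence α and its agreement with `alphaHat`.

  α : ℤ → Carrier
  α m = X m - Q (ℤ.- m) * X (ℤ.- m)

  -- The first reflection replaces the negative-index half of α by the neighbour X⁺ k. This form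
  -- makes the case n = 0 telescope. As `X⁺` vanishes at indices 1 modulo 3, it also yields the
  -- cases of `alphaHat`, with two powers only for k ≡ 2.
  α-suc : ∀ k → α (+ suc k) ≈ X⁺ (suc k) + Q (+ k) * X⁺ k
  α-suc k = +-congˡ (trans
    (-‿cong (QX-reflect-1 (+ k) -[1+ k ] (eq (+ k)))) (-‿involutive _))
    where
      eq : ∀ k → k ℤ.+ ℤ.- (+ 1 ℤ.+ k) ≡ ℤ.- + 1
      eq = solve-∀

  X⁺-3s : ∀ s → X⁺ (s ℕ.* 3) ≈ Q (+ 6 ℤ.* + s ℤ.* + s ℤ.- + s)
  X⁺-3s zero    = refl
  X⁺-3s (suc s) = trans (*-congˡ (X⁺-3s s))
    (Q-*-≡ (+ 4 ℤ.* + (s ℕ.* 3) ℤ.+ + 5) (+ 6 ℤ.* + s ℤ.* + s ℤ.- + s)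
      (≡.trans (≡.cong (λ n → + 4 ℤ.* n ℤ.+ + 5 ℤ.+ (+ 6 ℤ.* + s ℤ.* + s ℤ.- + s)) (ℤₚ.pos-* s 3)) (eq (+ s))))
    where
      eq : ∀ s → + 4 ℤ.* (s ℤ.* + 3) ℤ.+ + 5 ℤ.+ (+ 6 ℤ.* s ℤ.* s ℤ.- s)
               ≡ + 6 ℤ.* (+ 1 ℤ.+ s) ℤ.* (+ 1 ℤ.+ s) ℤ.- (+ 1 ℤ.+ s)
      eq = solve-∀

  X⁺-3s+1 : ∀ s → X⁺ (1 ℕ.+ s ℕ.* 3) ≈ 0#
  X⁺-3s+1 zero    = refl
  X⁺-3s+1 (suc s) = trans (*-congˡ (X⁺-3s+1 s)) (zeroʳ _)

  X⁺-3s+2 : ∀ s → X⁺ (2 ℕ.+ s ℕ.* 3) ≈ - Q (+ 6 ℤ.* + s ℤ.* + s ℤ.+ + 7 ℤ.* + s ℤ.+ + 2)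
  X⁺-3s+2 zero    = refl
  X⁺-3s+2 (suc s) = begin
    Q x * X⁺ (2 ℕ.+ s ℕ.* 3)   ≈⟨ *-congˡ (X⁺-3s+2 s) ⟩
    Q x * - Q y                ≈⟨ solve 2 (λ x y → x :* :- y := :- (x :* y)) refl _ _ ⟩
    - (Q x * Q y)
      ≈⟨ -‿cong (Q-*-≡ x y (≡.trans (≡.cong (λ n → + 4 ℤ.* (+ 2 ℤ.+ n) ℤ.+ + 5 ℤ.+ y) (ℤₚ.pos-* s 3)) (eq (+ s)))) ⟩
    - Q (+ 6 ℤ.* + suc s ℤ.* + suc s ℤ.+ + 7 ℤ.* + suc s ℤ.+ + 2) ∎
    where
      x = + 4 ℤ.* + (2 ℕ.+ s ℕ.* 3) ℤ.+ + 5
      y = + 6 ℤ.* + s ℤ.* + s ℤ.+ + 7 ℤ.* + s ℤ.+ + 2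
      eq : ∀ s → + 4 ℤ.* (+ 2 ℤ.+ s ℤ.* + 3) ℤ.+ + 5 ℤ.+ (+ 6 ℤ.* s ℤ.* s ℤ.+ + 7 ℤ.* s ℤ.+ + 2)
               ≡ + 6 ℤ.* (+ 1 ℤ.+ s) ℤ.* (+ 1 ℤ.+ s) ℤ.+ + 7 ℤ.* (+ 1 ℤ.+ s) ℤ.+ + 2
      eq = solve-∀

  private
    -- alphaHat k in terms of s = k / 3 and r = k % 3
    branch : ℕ → ℕ → Carrier
    branch s 0 = pow F q (6 ℕ.* s ℕ.* s ℕ.+ 2 ℕ.* s)
    branch s 1 = - pow F q (6 ℕ.* s ℕ.* s ℕ.+ 7 ℕ.* s ℕ.+ 2)
    branch s _ = pow F q (6 ℕ.* suc s ℕ.* suc s ℕ.∸ suc s) - pow F q (6 ℕ.* suc s ℕ.* suc s ℕ.∸ 2 ℕ.* suc s)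

    alphaHat-branch : ∀ k → alphaHat F q k ≡ branch (k ℕ./ 3) (k ℕ.% 3)
    alphaHat-branch k with k ℕ.% 3
    ... | 0 = ≡.refl
    ... | 1 = ≡.refl
    ... | suc (suc _) = ≡.refl

    pos-sq : ∀ a s → + (a ℕ.* s ℕ.* s) ≡ + a ℤ.* + s ℤ.* + s
    pos-sq a s = ≡.trans (ℤₚ.pos-* (a ℕ.* s) s) (≡.cong (ℤ._* + s) (ℤₚ.pos-* a s))

    pos-∸ : ∀ {m n} → n ℕ.≤ m → + (m ℕ.∸ n) ≡ + m ℤ.- + n
    pos-∸ {m} {n} n≤m = ≡.sym (≡.trans (ℤₚ.m-n≡m⊖n m n) (ℤₚ.⊖-≥ n≤m))

    -- Ensures that the subtractions `∸` in the exponents of `branch` never truncate.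
    a*s≤6ss : ∀ a s → a ℕ.≤ 6 → a ℕ.* suc s ℕ.≤ 6 ℕ.* suc s ℕ.* suc s
    a*s≤6ss a s a≤6 = ℕₚ.≤-trans (ℕₚ.*-monoˡ-≤ (suc s) a≤6) (ℕₚ.m≤m*n (6 ℕ.* suc s) (suc s))

    branch-α : ∀ s r → r ℕ.< 3 → branch s r ≈ X⁺ (suc (r ℕ.+ s ℕ.* 3)) + Q (+ (r ℕ.+ s ℕ.* 3)) * X⁺ (r ℕ.+ s ℕ.* 3)
    branch-α s 0 _ = sym (begin
      X⁺ (1 ℕ.+ s ℕ.* 3) + Q (+ (s ℕ.* 3)) * X⁺ (s ℕ.* 3)
        ≈⟨ +-cong (X⁺-3s+1 s) (*-cong (Q-≡ (ℤₚ.pos-* s 3)) (X⁺-3s s)) ⟩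
      0# + Q (+ s ℤ.* + 3) * Q (+ 6 ℤ.* + s ℤ.* + s ℤ.- + s)
        ≈⟨ trans (+-identityˡ _) (Q-*-≡ (+ s ℤ.* + 3) (+ 6 ℤ.* + s ℤ.* + s ℤ.- + s) (eq (+ s))) ⟩
      Q (+ 6 ℤ.* + s ℤ.* + s ℤ.+ + 2 ℤ.* + s)
        ≈⟨ Q-≡ (≡.sym (≡.cong₂ ℤ._+_ (pos-sq 6 s) (ℤₚ.pos-* 2 s))) ⟩
      pow F q (6 ℕ.* s ℕ.* s ℕ.+ 2 ℕ.* s) ∎)
      where
        eq : ∀ s → s ℤ.* + 3 ℤ.+ (+ 6 ℤ.* s ℤ.* s ℤ.- s) ≡ + 6 ℤ.* s ℤ.* s ℤ.+ + 2 ℤ.* s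
        eq = solve-∀
    branch-α s 1 _ = sym (begin
      X⁺ (2 ℕ.+ s ℕ.* 3) + Q (+ (1 ℕ.+ s ℕ.* 3)) * X⁺ (1 ℕ.+ s ℕ.* 3)
        ≈⟨ +-cong (X⁺-3s+2 s) (trans (*-congˡ (X⁺-3s+1 s)) (zeroʳ _)) ⟩
      - Q (+ 6 ℤ.* + s ℤ.* + s ℤ.+ + 7 ℤ.* + s ℤ.+ + 2) + 0#
        ≈⟨ +-identityʳ _ ⟩
      - Q (+ 6 ℤ.* + s ℤ.* + s ℤ.+ + 7 ℤ.* + s ℤ.+ + 2)
        ≈⟨ -‿cong (Q-≡ (≡.sym (≡.cong (ℤ._+ + 2) (≡.cong₂ ℤ._+_ (pos-sq 6 s) (ℤₚ.pos-* 7 s))))) ⟩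
      - pow F q (6 ℕ.* s ℕ.* s ℕ.+ 7 ℕ.* s ℕ.+ 2) ∎)
    branch-α s 2 _ = sym (begin
      X⁺ (suc s ℕ.* 3) + Q (+ (2 ℕ.+ s ℕ.* 3)) * X⁺ (2 ℕ.+ s ℕ.* 3)
        ≈⟨ +-cong (X⁺-3s (suc s)) (*-cong (Q-≡ (≡.cong (λ n → + 2 ℤ.+ n) (ℤₚ.pos-* s 3))) (X⁺-3s+2 s)) ⟩
      Q A + Q B * - Q C
        ≈⟨ +-congˡ (solve 2 (λ x y → x :* :- y := :- (x :* y)) refl _ _) ⟩
      Q A - Q B * Q C
        ≈⟨ +-congˡ (-‿cong (Q-*-≡ B C (eq (+ s)))) ⟩
      Q A - Q D
        ≈⟨ +-cong (Q-≡ (≡.sym A≡)) (-‿cong (Q-≡ (≡.sym D≡))) ⟩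
      branch s 2 ∎)
      where
        A = + 6 ℤ.* + suc s ℤ.* + suc s ℤ.- + suc s
        B = + 2 ℤ.+ + s ℤ.* + 3
        C = + 6 ℤ.* + s ℤ.* + s ℤ.+ + 7 ℤ.* + s ℤ.+ + 2
        D = + 6 ℤ.* + suc s ℤ.* + suc s ℤ.- + 2 ℤ.* + suc s
        eq : ∀ s → + 2 ℤ.+ s ℤ.* + 3 ℤ.+ (+ 6 ℤ.* s ℤ.* s ℤ.+ + 7 ℤ.* s ℤ.+ + 2)
                 ≡ + 6 ℤ.* (+ 1 ℤ.+ s) ℤ.* (+ 1 ℤ.+ s) ℤ.- + 2 ℤ.* (+ 1 ℤ.+ s)
        eq = solve-∀
        A≡ : + (6 ℕ.* suc s ℕ.* suc s ℕ.∸ suc s) ≡ A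
        A≡ = ≡.trans (pos-∸ (≡.subst (ℕ._≤ 6 ℕ.* suc s ℕ.* suc s) (ℕₚ.*-identityˡ (suc s)) (a*s≤6ss 1 s (s≤s z≤n))))
                     (≡.cong (ℤ._- + suc s) (pos-sq 6 (suc s)))
        D≡ : + (6 ℕ.* suc s ℕ.* suc s ℕ.∸ 2 ℕ.* suc s) ≡ D
        D≡ = ≡.trans (pos-∸ (a*s≤6ss 2 s (s≤s (s≤s z≤n))))
                     (≡.cong₂ ℤ._-_ (pos-sq 6 (suc s)) (ℤₚ.pos-* 2 (suc s)))
    branch-α s (suc (suc (suc r))) (s≤s (s≤s (s≤s ())))

  alphaHat-α : ∀ k → alphaHat F q k ≈ α (+ suc k)
  alphaHat-α k = begin
    alphaHat F q k                ≡⟨ alphaHat-branch k ⟩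
    branch (k ℕ./ 3) (k ℕ.% 3)    ≈⟨ branch-α (k ℕ./ 3) (k ℕ.% 3) (DM.m%n<n k 3) ⟩
    X⁺ (suc k′) + Q (+ k′) * X⁺ k′
      ≡⟨ ≡.cong (λ n → X⁺ (suc n) + Q (+ n) * X⁺ n) (DM.m≡m%n+[m/n]*n k 3) ⟨
    X⁺ (suc k) + Q (+ k) * X⁺ k   ≈⟨ α-suc k ⟨
    α (+ suc k)                   ∎
    where k′ = k ℕ.% 3 ℕ.+ k ℕ./ 3 ℕ.* 3

-- Gaussian binomials at a primitive N-th root of unity.

module RootOfUnity {c ℓ} (F : Field0 c ℓ) (N′ : ℕ) (q : Field0.Carrier F)
                   (root : PrimitiveRoot F (suc N′) q) where
  open Field0 F
  open import Relation.Binary.Reasoning.Setoid setoid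
  open FieldArithmetic F

  N : ℕ
  N = suc N′

  q≉0 : ¬ (q ≈ 0#)
  q≉0 q≈0 = 1≉0 (trans (sym (proj₁ root)) (trans (*-congʳ q≈0) (zeroˡ _)))

  open QCalculus F q q≉0
  open FalseTheta F q q≉0

  Q-N : Q (+ N) ≈ 1#
  Q-N = proj₁ root

  Q-+N : ∀ i → Q (+ N ℤ.+ i) ≈ Q i
  Q-+N i = trans (Q-+ (+ N) i) (trans (*-congʳ Q-N) (*-identityˡ _))

  Q-mod : ∀ i j → i ≡ + N ℤ.+ j → Q i ≈ Q j
  Q-mod i j e = trans (Q-≡ e) (Q-+N j)

  1-Q-nonzero : ∀ {k} → 0 ℕ.< k → k ℕ.< N → Nonzero (1# - Q (+ k))
  1-Q-nonzero {k} 0<k k<N = 1-x-nonzero (proj₂ root k 0<k k<N)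

  q!-nonzero : ∀ {k} → k ℕ.< N → Nonzero (q! k)
  q!-nonzero {zero}  _   = 1≉0
  q!-nonzero {suc k} k<N = *-nonzero (q!-nonzero (ℕₚ.<-trans ℕₚ.≤-refl k<N)) (1-Q-nonzero (s≤s z≤n) k<N)

  -- `gb-ratio` at k = 0 carries the factor 1 - q^N = 0, and the zero spreads along the row because
  -- each 1 - q^(k+1) below N can be cancelled.
  gb-N : ∀ k → suc k ℕ.< N → gb N (suc k) ≈ 0#
  gb-N k k<N = *-cancelˡ-nonzero (1-Q-nonzero (s≤s z≤n) k<N)
    (trans (gb-ratio N k) (trans (rhs k k<N) (sym (zeroʳ _))))
    where
      rhs : ∀ k → suc k ℕ.< N → (1# - Q (+ N ℤ.- + k)) * gb N k ≈ 0#
      rhs zero    _ = begin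
        (1# - Q (+ N ℤ.- + 0)) * 1#
          ≈⟨ *-congʳ (+-congˡ (-‿cong (Q-+N (+ 0)))) ⟩
        (1# - 1#) * 1#
          ≈⟨ solve 0 ((con (+ 1) :- con (+ 1)) :* con (+ 1) := con (+ 0)) refl ⟩
        0# ∎
      rhs (suc k) k<N = trans (*-congˡ (gb-N k (ℕₚ.<-trans ℕₚ.≤-refl k<N))) (zeroʳ _)

  S-N : ∀ f → S N f ≈ f 0 + f N
  S-N f = begin
    S N f
      ≈⟨ S-gb N f ⟩
    ∑ N (λ k → gb N k * f k) + gb N N * f N
      ≈⟨ +-cong (∑-head N′ _) (trans (*-congʳ (gb-diag N)) (*-identityˡ _)) ⟩
    1# * f 0 + ∑ N′ (λ k → gb N (suc k) * f (suc k)) + f N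
      ≈⟨ +-congʳ (+-cong (*-identityˡ _) (∑-zero< N′ (λ k k<N′ →
           trans (*-congʳ (gb-N k (s≤s k<N′))) (zeroˡ _)))) ⟩
    f 0 + 0# + f N
      ≈⟨ +-congʳ (+-identityʳ _) ⟩
    f 0 + f N ∎

  -- A q-Lucas rule, [a+N, k] = [a, k] + [a, k-N]. The Pascal coefficient q^k has period N, so
  -- primitivity is needed only for the base row N.
  S-+N : ∀ a f → S (a ℕ.+ N) f ≈ S a (λ k → f k + f (N ℕ.+ k))
  S-+N zero    f = trans (S-N f) (+-congˡ (reflexive (≡.cong f (≡.sym (ℕₚ.+-identityʳ N)))))
  S-+N (suc a) f = begin
    S (a ℕ.+ N) (pascal f)
      ≈⟨ S-+N a (pascal f) ⟩
    S a (λ k → pascal f k + (f (suc (N ℕ.+ k)) + Q (+ (N ℕ.+ k)) * f (N ℕ.+ k)))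
      ≈⟨ S-cong a (λ k → +-congˡ (+-cong (reflexive (≡.cong f (≡.sym (ℕₚ.+-suc N k)))) (*-congʳ (Q-+N (+ k))))) ⟩
    S a (λ k → f (suc k) + Q (+ k) * f k + (f (N ℕ.+ suc k) + Q (+ k) * f (N ℕ.+ k)))
      ≈⟨ S-cong a (λ k → solve 5 (λ a b x c d → a :+ x :* b :+ (c :+ x :* d) := a :+ c :+ x :* (b :+ d)) refl _ _ _ _ _) ⟩
    S a (pascal (λ k → f k + f (N ℕ.+ k))) ∎

  -- Both products are the q-trinomial (q)ₙ₊ᵢ₊ⱼ / ((q)ₙ (q)ᵢ (q)ⱼ), whose denominator can be
  -- cancelled below N.
  gb-trinomial : ∀ n i j → n ℕ.+ (i ℕ.+ j) ℕ.< N →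
    gb (n ℕ.+ (i ℕ.+ j)) (n ℕ.+ i) * gb (n ℕ.+ i) n ≈ gb (n ℕ.+ (i ℕ.+ j)) n * gb (i ℕ.+ j) i
  gb-trinomial n i j m<N = *-cancelˡ-nonzero
    (*-nonzero (*-nonzero (q!-nonzero n<N) (q!-nonzero i<N)) (q!-nonzero j<N)) (begin
    q! n * q! i * q! j * (g₁ * g₂)
      ≈⟨ solve 5 (λ a b c x y → a :* b :* c :* (x :* y) := a :* b :* y :* c :* x) refl _ _ _ _ _ ⟩
    q! n * q! i * g₂ * q! j * g₁
      ≈⟨ *-congʳ (*-congʳ (gb-factorial n i)) ⟩
    q! (n ℕ.+ i) * q! j * g₁
      ≡⟨ ≡.cong (λ m → q! (n ℕ.+ i) * q! j * gb m (n ℕ.+ i)) (ℕₚ.+-assoc n i j) ⟨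
    q! (n ℕ.+ i) * q! j * gb (n ℕ.+ i ℕ.+ j) (n ℕ.+ i)
      ≈⟨ gb-factorial (n ℕ.+ i) j ⟩
    q! (n ℕ.+ i ℕ.+ j)
      ≡⟨ ≡.cong q! (ℕₚ.+-assoc n i j) ⟩
    q! (n ℕ.+ (i ℕ.+ j))
      ≈⟨ gb-factorial n (i ℕ.+ j) ⟨
    q! n * q! (i ℕ.+ j) * g₃
      ≈⟨ *-congʳ (*-congˡ (gb-factorial i j)) ⟨
    q! n * (q! i * q! j * g₄) * g₃
      ≈⟨ solve 5 (λ a b c x y → a :* (b :* c :* y) :* x := a :* b :* c :* (x :* y)) refl _ _ _ _ _ ⟩
    q! n * q! i * q! j * (g₃ * g₄) ∎)
    where
      g₁ = gb (n ℕ.+ (i ℕ.+ j)) (n ℕ.+ i)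
      g₂ = gb (n ℕ.+ i) n
      g₃ = gb (n ℕ.+ (i ℕ.+ j)) n
      g₄ = gb (i ℕ.+ j) i
      n<N : n ℕ.< N
      n<N = ℕₚ.≤-<-trans (ℕₚ.m≤m+n n _) m<N
      i+j<N : i ℕ.+ j ℕ.< N
      i+j<N = ℕₚ.≤-<-trans (ℕₚ.m≤n+m _ n) m<N
      i<N : i ℕ.< N
      i<N = ℕₚ.≤-<-trans (ℕₚ.m≤m+n i j) i+j<N
      j<N : j ℕ.< N
      j<N = ℕₚ.≤-<-trans (ℕₚ.m≤n+m j i) i+j<N

  qbin-gb : ∀ m n → n ℕ.≤ m → m ℕ.< N → qbin F q m n ≈ gb m n
  qbin-gb m n n≤m m<N = *-cancelˡ-nonzero d≉0 (begin
    d * (q! m * inv d)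
      ≈⟨ solve 3 (λ d x i → d :* (x :* i) := x :* (d :* i)) refl _ _ _ ⟩
    q! m * (d * inv d)
      ≈⟨ trans (*-congˡ (inv-r d d≉0)) (*-identityʳ _) ⟩
    q! m
      ≡⟨ ≡.cong q! n+j≡m ⟨
    q! (n ℕ.+ (m ℕ.∸ n))
      ≈⟨ gb-factorial n (m ℕ.∸ n) ⟨
    q! n * q! (m ℕ.∸ n) * gb (n ℕ.+ (m ℕ.∸ n)) n
      ≈⟨ *-cong (*-comm _ _) (reflexive (≡.cong (λ m → gb m n) n+j≡m)) ⟩
    d * gb m n ∎)
    where
      d = q! (m ℕ.∸ n) * q! n
      n+j≡m : n ℕ.+ (m ℕ.∸ n) ≡ m
      n+j≡m = ℕₚ.m+[n∸m]≡n n≤m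
      d≉0 : Nonzero d
      d≉0 = *-nonzero (q!-nonzero (ℕₚ.≤-<-trans (ℕₚ.m∸n≤m m n) m<N))
                      (q!-nonzero (ℕₚ.≤-<-trans n≤m m<N))

  -- The weights λ as eigenvectors of the chain step.

  -- lam m j = qʲ (qᵐ)ⱼ (q⁻ᵐ)ⱼ / (q)ⱼ, written without division.
  lam : ℕ → ℕ → Carrier
  lam m j = poch F q (Q (+ m)) j * g m j * gb m j

  lam-0 : ∀ m → lam m 0 ≈ 1#
  lam-0 m = solve 0 (con (+ 1) :* con (+ 1) :* con (+ 1) := con (+ 1)) refl

  lam-> : ∀ m j → m ℕ.< j → lam m j ≈ 0#
  lam-> m j m<j = trans (*-congˡ (gb-> m j m<j)) (zeroʳ _)

  poch-vanish-N : ∀ m n → m ℕ.≤ N → N ℕ.< m ℕ.+ n → poch F q (Q (+ m)) n ≈ 0#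
  poch-vanish-N m n m≤N N<m+n = poch-vanish n (N ℕ.∸ m)
    (ℕₚ.+-cancelˡ-< m _ _ (≡.subst (ℕ._< m ℕ.+ n) (≡.sym m+k≡N) N<m+n))
    (trans (Q-*-≡ (+ m) (+ (N ℕ.∸ m)) (≡.cong +_ m+k≡N)) Q-N)
    where
      m+k≡N = ℕₚ.m+[n∸m]≡n m≤N

  lam-vanish : ∀ m n → m ℕ.≤ N → N ℕ.< m ℕ.+ n → lam m n ≈ 0#
  lam-vanish m n m≤N N<m+n = begin
    poch F q (Q (+ m)) n * g m n * gb m n
      ≈⟨ *-congʳ (*-congʳ (poch-vanish-N m n m≤N N<m+n)) ⟩
    0# * g m n * gb m n
      ≈⟨ solve 2 (λ x y → con (+ 0) :* x :* y := con (+ 0)) refl _ _ ⟩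
    0# ∎

  -- With j = n + i the summand is `lam m n` times the q-Chu-Vandermonde summand for M = m - n and b
  -- = q^(m+n), and b^M = q^(m²-n²). The factor q^(n²) of the chain then cancels all dependence of
  -- the eigenvalue on n.
  ∑-lam-gb : ∀ m n → m ℕ.< N →
    ∑ N (λ j → lam m j * gb j n) ≈ Q (+ m ℤ.* + m ℤ.- + n ℤ.* + n) * lam m n
  ∑-lam-gb m n m<N with n ℕ.≤? m
  ... | no n≰m = trans
    (∑-zero< N (λ j _ → zero-term j))
    (sym (trans (*-congˡ (lam-> m n (ℕₚ.≰⇒> n≰m))) (zeroʳ _)))
    where
      zero-term : ∀ j → lam m j * gb j n ≈ 0#
      zero-term j with j ℕ.<? n
      ... | yes j<n = trans (*-congˡ (gb-> j n j<n)) (zeroʳ _)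
      ... | no  j≮n = trans (*-congʳ (lam-> m j (ℕₚ.<-≤-trans (ℕₚ.≰⇒> n≰m) (ℕₚ.≮⇒≥ j≮n)))) (zeroˡ _)
  ... | yes n≤m with ℕₚ.m≤n⇒∃[o]m+o≡n n≤m | ℕₚ.m≤n⇒∃[o]m+o≡n m<N
  ... | M , ≡.refl | r , N≡ = begin
    ∑ N t
      ≡⟨ ≡.cong (λ k → ∑ k t) (≡.trans (≡.sym N≡) (≡.cong (ℕ._+ r) (≡.sym (ℕₚ.+-suc n M)))) ⟩
    ∑ (n ℕ.+ suc M ℕ.+ r) t
      ≈⟨ ∑-window n (suc M) r t (λ j j<n → trans (*-congˡ (gb-> j n j<n)) (zeroʳ _))
           (λ j m<j _ → trans (*-congʳ (lam-> m j (≡.subst (ℕ._≤ j) (ℕₚ.+-suc n M) m<j))) (zeroˡ _)) ⟩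
    ∑ (suc M) (λ i → t (n ℕ.+ i))
      ≈⟨ ∑-cong< (suc M) (λ i i≤M → term i (ℕₚ.≤-pred i≤M)) ⟩
    ∑ (suc M) (λ i → lam m n * (gb M i * (g M i * poch F q b i)))
      ≈⟨ *-distribˡ-∑ (lam m n) (suc M) _ ⟨
    lam m n * ∑ (suc M) (λ i → gb M i * (g M i * poch F q b i))
      ≈⟨ *-congˡ (S-gb M _) ⟨
    lam m n * S M (λ i → g M i * poch F q b i)
      ≈⟨ *-congˡ (trans (vandermonde M b) (pow-Q (+ m ℤ.+ + n) M)) ⟩
    lam m n * Q (+ M ℤ.* (+ m ℤ.+ + n))
      ≈⟨ trans (*-comm _ _) (*-congʳ (Q-≡ (eq (+ n) (+ M)))) ⟩
    Q (+ m ℤ.* + m ℤ.- + n ℤ.* + n) * lam m n ∎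
    where
      b = Q (+ m ℤ.+ + n)
      t : ℕ → Carrier
      t j = lam m j * gb j n
      eq : ∀ n M → M ℤ.* (n ℤ.+ M ℤ.+ n) ≡ (n ℤ.+ M) ℤ.* (n ℤ.+ M) ℤ.- n ℤ.* n
      eq = solve-∀
      trinomial : ∀ i → i ℕ.≤ M → gb m (n ℕ.+ i) * gb (n ℕ.+ i) n ≈ gb m n * gb M i
      trinomial i i≤M with ℕₚ.m≤n⇒∃[o]m+o≡n i≤M
      ... | j , ≡.refl = gb-trinomial n i j m<N
      term : ∀ i → i ℕ.≤ M → t (n ℕ.+ i) ≈ lam m n * (gb M i * (g M i * poch F q b i))
      term i i≤M = begin
        poch F q (Q (+ m)) (n ℕ.+ i) * g m (n ℕ.+ i) * gb m (n ℕ.+ i) * gb (n ℕ.+ i) n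
          ≈⟨ *-assoc _ _ _ ⟩
        poch F q (Q (+ m)) (n ℕ.+ i) * g m (n ℕ.+ i) * (gb m (n ℕ.+ i) * gb (n ℕ.+ i) n)
          ≈⟨ *-cong (*-cong (poch-+ (+ m) n i) (g-+ M n i)) (trinomial i i≤M) ⟩
        poch F q (Q (+ m)) n * poch F q b i * (g m n * g M i) * (gb m n * gb M i)
          ≈⟨ solve 6 (λ p p′ a b x y → p :* p′ :* (a :* b) :* (x :* y) := p :* a :* x :* (y :* (b :* p′)))
               refl _ _ _ _ _ _ ⟩
        lam m n * (gb M i * (g M i * poch F q b i)) ∎

  ∑-lam-chainSum : ∀ p m → m ℕ.< N →
    ∑ N (λ j → lam m j * chainSum F q p j) ≈ Q (+ suc p ℤ.* (+ m ℤ.* + m))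
  ∑-lam-chainSum zero m m<N = begin
    -- The empty chain 1 is read as [j 0], which already contributes one q^(m²); hence the exponent
    -- p + 1 for p levels.
    ∑ N (λ j → lam m j * gb j 0)
      ≈⟨ ∑-lam-gb m 0 m<N ⟩
    Q (+ m ℤ.* + m ℤ.- + 0 ℤ.* + 0) * lam m 0
      ≈⟨ trans (*-congˡ (lam-0 m)) (*-identityʳ _) ⟩
    Q (+ m ℤ.* + m ℤ.- + 0 ℤ.* + 0)
      ≈⟨ Q-≡ (eq (+ m)) ⟩
    Q (+ 1 ℤ.* (+ m ℤ.* + m)) ∎
    where
      eq : ∀ m → m ℤ.* m ℤ.- + 0 ℤ.* + 0 ≡ + 1 ℤ.* (m ℤ.* m)
      eq = solve-∀
  ∑-lam-chainSum (suc p) m m<N = begin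
    ∑ N (λ j → lam m j * chainSum F q (suc p) j)
      ≈⟨ ∑-cong< N (λ j j<N → trans (*-congˡ (extend j j<N)) (*-distribˡ-∑ (lam m j) N _)) ⟩
    ∑ N (λ j → ∑ N (λ n → lam m j * (w n * gb j n * G n)))
      ≈⟨ ∑-swap N N _ ⟩
    ∑ N (λ n → ∑ N (λ j → lam m j * (w n * gb j n * G n)))
      ≈⟨ ∑-cong N column ⟩
    ∑ N (λ n → Q (+ m ℤ.* + m) * (lam m n * G n))
      ≈⟨ *-distribˡ-∑ _ N _ ⟨
    Q (+ m ℤ.* + m) * ∑ N (λ n → lam m n * G n)
      ≈⟨ *-congˡ (∑-lam-chainSum p m m<N) ⟩
    Q (+ m ℤ.* + m) * Q (+ suc p ℤ.* (+ m ℤ.* + m))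
      ≈⟨ Q-*-≡ (+ m ℤ.* + m) (+ suc p ℤ.* (+ m ℤ.* + m)) (eq (+ p) (+ m ℤ.* + m)) ⟩
    Q (+ suc (suc p) ℤ.* (+ m ℤ.* + m)) ∎
    where
      G w : ℕ → Carrier
      G = chainSum F q p
      w n = Q (+ n ℤ.* + n)
      eq : ∀ p x → x ℤ.+ (+ 1 ℤ.+ p) ℤ.* x ≡ (+ 2 ℤ.+ p) ℤ.* x
      eq = solve-∀
      eq′ : ∀ m n → n ℤ.+ (m ℤ.- n) ≡ m
      eq′ = solve-∀
      -- The binomial vanishes past n = j, so the inner range is made independent of j before the
      -- sums are exchanged.
      extend : ∀ j → j ℕ.< N → chainSum F q (suc p) j ≈ ∑ N (λ n → w n * gb j n * G n)
      extend j j<N with ℕₚ.m≤n⇒∃[o]m+o≡n j<N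
      ... | r , j+r≡N = begin
        ∑ (suc j) (λ n → pow F q (n ℕ.* n) * qbin F q j n * G n)
          ≈⟨ ∑-cong< (suc j) (λ n n≤j → *-congʳ (*-cong (Q-≡ (ℤₚ.pos-* n n)) (qbin-gb j n (ℕₚ.≤-pred n≤j) j<N))) ⟩
        ∑ (suc j) u
          ≈⟨ ∑-window 0 (suc j) r u (λ _ ()) (λ n j<n _ → trans (*-congʳ (trans (*-congˡ (gb-> j n j<n)) (zeroʳ _))) (zeroˡ _)) ⟨
        ∑ (suc j ℕ.+ r) u
          ≡⟨ ≡.cong (λ k → ∑ k u) j+r≡N ⟩
        ∑ N u ∎
        where
          u : ℕ → Carrier
          u n = w n * gb j n * G n
      column : ∀ n → ∑ N (λ j → lam m j * (w n * gb j n * G n)) ≈ Q (+ m ℤ.* + m) * (lam m n * G n)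
      column n = begin
        ∑ N (λ j → lam m j * (w n * gb j n * G n))
          ≈⟨ ∑-cong N (λ j → solve 4 (λ l w b G → l :* (w :* b :* G) := w :* G :* (l :* b)) refl _ _ _ _) ⟩
        ∑ N (λ j → w n * G n * (lam m j * gb j n))
          ≈⟨ *-distribˡ-∑ _ N _ ⟨
        w n * G n * ∑ N (λ j → lam m j * gb j n)
          ≈⟨ *-congˡ (∑-lam-gb m n m<N) ⟩
        w n * G n * (Q (+ m ℤ.* + m ℤ.- + n ℤ.* + n) * lam m n)
          ≈⟨ solve 4 (λ w G x l → w :* G :* (x :* l) := w :* x :* (l :* G)) refl _ _ _ _ ⟩
        w n * Q (+ m ℤ.* + m ℤ.- + n ℤ.* + n) * (lam m n * G n)
          ≈⟨ *-congʳ (Q-*-≡ (+ n ℤ.* + n) (+ m ℤ.* + m ℤ.- + n ℤ.* + n) (eq′ (+ m ℤ.* + m) (+ n ℤ.* + n))) ⟩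
        Q (+ m ℤ.* + m) * (lam m n * G n) ∎

  -- At m = 0 only j = 0 survives in `lam`, so the eigenvalue q⁰ is itself the value sought.
  chainSum-0 : ∀ p → chainSum F q p 0 ≈ 1#
  chainSum-0 p = begin
    G 0                                             ≈⟨ *-identityˡ _ ⟨
    1# * G 0                                        ≈⟨ *-congʳ (lam-0 0) ⟨
    lam 0 0 * G 0                                   ≈⟨ +-identityʳ _ ⟨
    lam 0 0 * G 0 + 0#
      ≈⟨ +-congˡ (∑-zero< N′ (λ k _ → trans (*-congʳ (lam-> 0 (suc k) (s≤s z≤n))) (zeroˡ _))) ⟨
    lam 0 0 * G 0 + ∑ N′ (λ k → lam 0 (suc k) * G (suc k))   ≈⟨ ∑-head N′ _ ⟨
    ∑ N (λ j → lam 0 j * G j)                       ≈⟨ ∑-lam-chainSum p 0 (s≤s z≤n) ⟩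
    Q (+ suc p ℤ.* (+ 0 ℤ.* + 0))                   ≈⟨ Q-≡ (eq (+ suc p)) ⟩
    1#                                              ∎
    where
      G = chainSum F q p
      eq : ∀ p → p ℤ.* (+ 0 ℤ.* + 0) ≡ + 0
      eq = solve-∀

  -- Expansion of the outer weight for 0 < n < N.

  -- C m = (-1)^(m-1) q^(-m(m-1)/2), see C-suc
  C : ℕ → Carrier
  C zero    = - 1#
  C (suc m) = - (Q (ℤ.- + m) * C m)

  -- The quadratic exponents of `C` and `g` cancel, leaving one sign and an exponent linear in m.
  C-*-g : ∀ M m → C m * g M m ≈ - Q (+ m ℤ.- + M ℤ.* + m)
  C-*-g M zero    = begin
    - 1# * 1#                       ≈⟨ *-identityʳ _ ⟩
    - 1#                            ≈⟨ -‿cong (Q-≡ (eq (+ M))) ⟨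
    - Q (+ 0 ℤ.- + M ℤ.* + 0)       ∎
    where
      eq : ∀ M → + 0 ℤ.- M ℤ.* + 0 ≡ + 0
      eq = solve-∀
  C-*-g M (suc m) = begin
    - (Q (ℤ.- + m) * C m) * - (Q (+ suc m ℤ.- + M) * g M m)
      ≈⟨ solve 4 (λ x y z w → :- (x :* y) :* :- (z :* w) := x :* z :* (y :* w)) refl _ _ _ _ ⟩
    Q (ℤ.- + m) * Q (+ suc m ℤ.- + M) * (C m * g M m)
      ≈⟨ *-cong (Q-*-≡ (ℤ.- + m) (+ suc m ℤ.- + M) (eq (+ m) (+ M))) (C-*-g M m) ⟩
    Q (+ 1 ℤ.- + M) * - Q (+ m ℤ.- + M ℤ.* + m)
      ≈⟨ solve 2 (λ x y → x :* :- y := :- (x :* y)) refl _ _ ⟩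
    - (Q (+ 1 ℤ.- + M) * Q (+ m ℤ.- + M ℤ.* + m))
      ≈⟨ -‿cong (Q-*-≡ (+ 1 ℤ.- + M) (+ m ℤ.- + M ℤ.* + m) (eq′ (+ m) (+ M))) ⟩
    - Q (+ suc m ℤ.- + M ℤ.* + suc m) ∎
    where
      eq : ∀ m M → ℤ.- m ℤ.+ (+ 1 ℤ.+ m ℤ.- M) ≡ + 1 ℤ.- M
      eq = solve-∀
      eq′ : ∀ m M → + 1 ℤ.- M ℤ.+ (m ℤ.- M ℤ.* m) ≡ + 1 ℤ.+ m ℤ.- M ℤ.* (+ 1 ℤ.+ m)
      eq′ = solve-∀

  -- The q-Chu-Vandermonde sum with b = 0 and M = N has only two terms.
  g-N-N : 1# + g N N ≈ 0#
  g-N-N = begin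
    1# + g N N
      ≈⟨ +-cong (*-identityʳ 1#) (trans (*-congˡ (poch-0 N)) (*-identityʳ _)) ⟨
    g N 0 * poch F q 0# 0 + g N N * poch F q 0# N
      ≈⟨ S-N (λ i → g N i * poch F q 0# i) ⟨
    S N (λ i → g N i * poch F q 0# i)
      ≈⟨ vandermonde N 0# ⟩
    0# * pow F 0# N′
      ≈⟨ zeroˡ _ ⟩
    0# ∎

  -- A direct proof would split on the parity of N, with q^(N/2) = -1 for even N. Instead `g-N-N`
  -- gives g N N = -1, while `C-*-g` and q^N = 1 evaluate C N · g N N to -1.
  C-N : C N ≈ 1#
  C-N = begin
    C N
      ≈⟨ solve 2 (λ c h → c := c :* (con (+ 1) :+ h) :- c :* h) refl (C N) (g N N) ⟩
    C N * (1# + g N N) - C N * g N N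
      ≈⟨ +-cong (trans (*-congˡ g-N-N) (zeroʳ _)) (-‿cong (C-*-g N N)) ⟩
    0# - - Q (+ N ℤ.- + N ℤ.* + N)
      ≈⟨ solve 1 (λ x → con (+ 0) :- :- x := x) refl _ ⟩
    Q (+ N ℤ.- + N ℤ.* + N)
      ≈⟨ Q-+N (ℤ.- (+ N ℤ.* + N)) ⟩
    Q (ℤ.- (+ N ℤ.* + N))
      ≈⟨ *-identityˡ _ ⟨
    1# * Q (ℤ.- (+ N ℤ.* + N))
      ≈⟨ *-congʳ Q-N² ⟨
    Q (+ N ℤ.* + N) * Q (ℤ.- (+ N ℤ.* + N))
      ≈⟨ Q-inverse (+ N ℤ.* + N) ⟩
    1# ∎
    where
      Q-N² : Q (+ N ℤ.* + N) ≈ 1#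
      Q-N² = trans (sym (pow-Q (+ N) N)) (trans (pow-cong N Q-N) (pow-1 N))

  private
    eqν : ∀ n a k → n ℤ.+ (a ℤ.- k) ≡ n ℤ.+ a ℤ.- k
    eqν = solve-∀

  -- Since (1 - qᵐ) q⁻ᵐ = -(1 - q⁻ᵐ), the summand is h m + h(-m). The first half, reversed, and the
  -- second are the two blocks of row a + N = 2ν with ν = N - n, which `S-+N` rejoins.
  S-α : ∀ n a → n ℕ.+ n ℕ.+ a ≡ N →
    S a (λ k → (1# - Q (+ (n ℕ.+ k))) * α (+ (n ℕ.+ k))) ≈ 1# - Q (ℤ.- + n)
  S-α n a 2n+a≡N = begin
    S a (λ k → (1# - Q (+ (n ℕ.+ k))) * α (+ (n ℕ.+ k)))
      ≈⟨ S-cong a (λ k → fold (+ (n ℕ.+ k))) ⟩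
    S a (λ k → h (+ n ℤ.+ + k) + h (ℤ.- (+ n ℤ.+ + k)))
      ≈⟨ S-+ a _ _ ⟩
    S a (λ k → h (+ n ℤ.+ + k)) + S a (λ k → h (ℤ.- (+ n ℤ.+ + k)))
      ≈⟨ +-cong (S-reflect a (λ i → h (+ n ℤ.+ i))) refl ⟩
    S a (λ k → h (+ n ℤ.+ (+ a ℤ.- + k))) + S a (λ k → h (ℤ.- (+ n ℤ.+ + k)))
      ≈⟨ S-+ a _ _ ⟨
    S a (λ k → h (+ n ℤ.+ (+ a ℤ.- + k)) + h (ℤ.- (+ n ℤ.+ + k)))
      ≈⟨ S-cong a (λ k → +-cong (h-≡ (eqν (+ n) (+ a) (+ k))) (h-≡ (shift k))) ⟩
    S a (λ k → h (+ ν ℤ.- + k) + h (+ ν ℤ.- + (N ℕ.+ k)))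
      ≈⟨ S-+N a (λ k → h (+ ν ℤ.- + k)) ⟨
    S (a ℕ.+ N) (λ k → h (+ ν ℤ.- + k))
      ≡⟨ ≡.cong (λ m → S m (λ k → h (+ ν ℤ.- + k))) 2ν≡ ⟨
    S (ν ℕ.+ ν) (λ k → h (+ ν ℤ.- + k))
      ≈⟨ S-cong (ν ℕ.+ ν) (λ k → solve 2 (λ x y → (con (+ 1) :- x) :* y := y :+ :- (x :* y)) refl _ _) ⟩
    S (ν ℕ.+ ν) (λ k → X (+ ν ℤ.- + k) + - (Q (+ ν ℤ.- + k) * X (+ ν ℤ.- + k)))
      ≈⟨ S-+ (ν ℕ.+ ν) _ _ ⟩
    S (ν ℕ.+ ν) (λ k → X (+ ν ℤ.- + k)) + S (ν ℕ.+ ν) (λ k → - (Q (+ ν ℤ.- + k) * X (+ ν ℤ.- + k)))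
      ≈⟨ +-cong (S-X ν) (trans (S-neg (ν ℕ.+ ν) _) (-‿cong (S-QX ν))) ⟩
    1# - Q (+ ν)
      ≈⟨ +-congˡ (-‿cong (Q-mod (+ ν) (ℤ.- + n) (≡.trans (eq₁ (+ n) (+ a)) (≡.cong (λ m → + m ℤ.+ ℤ.- + n) 2n+a≡N)))) ⟩
    1# - Q (ℤ.- + n) ∎
    where
      ν = n ℕ.+ a
      h : ℤ → Carrier
      h m = (1# - Q m) * X m
      h-≡ : ∀ {i j} → i ≡ j → h i ≈ h j
      h-≡ e = reflexive (≡.cong h e)
      eq₁ : ∀ n a → n ℤ.+ a ≡ n ℤ.+ n ℤ.+ a ℤ.+ ℤ.- n
      eq₁ = solve-∀
      eq₂ : ∀ n a k → ℤ.- (n ℤ.+ k) ≡ n ℤ.+ a ℤ.- (n ℤ.+ n ℤ.+ a ℤ.+ k)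
      eq₂ = solve-∀
      shift : ∀ k → ℤ.- (+ n ℤ.+ + k) ≡ + ν ℤ.- + (N ℕ.+ k)
      shift k = ≡.trans (eq₂ (+ n) (+ a) (+ k)) (≡.cong (λ m → + ν ℤ.- + (m ℕ.+ k)) 2n+a≡N)
      2ν≡ : ν ℕ.+ ν ≡ a ℕ.+ N
      2ν≡ = ℤₚ.+-injective (≡.trans (eq₃ (+ n) (+ a)) (≡.cong (λ m → + a ℤ.+ + m) 2n+a≡N))
        where
          eq₃ : ∀ n a → n ℤ.+ a ℤ.+ (n ℤ.+ a) ≡ a ℤ.+ (n ℤ.+ n ℤ.+ a)
          eq₃ = solve-∀
      fold : ∀ m → (1# - Q m) * α m ≈ h m + h (ℤ.- m)
      fold m = begin
        (1# - Q m) * (X m - Q (ℤ.- m) * X (ℤ.- m))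
          ≈⟨ solve 4 (λ x y a b → (con (+ 1) :- x) :* (a :- y :* b)
                       := (con (+ 1) :- x) :* a :+ (x :* y :- y) :* b) refl _ _ _ _ ⟩
        h m + (Q m * Q (ℤ.- m) - Q (ℤ.- m)) * X (ℤ.- m)
          ≈⟨ +-congˡ (*-congʳ (+-congʳ (Q-inverse m))) ⟩
        h m + h (ℤ.- m) ∎

  -- At q^N = 1 the weights C m * lam m n become the q-binomials of S-α.
  C-*-lam : ∀ n a → 0 ℕ.< n → n ℕ.+ n ℕ.+ a ≡ N → ∀ k → k ℕ.≤ a →
    (1# - Q (+ n)) * (C (n ℕ.+ k) * lam (n ℕ.+ k) n)
      ≈ - (Q (+ n ℤ.- + n ℤ.* + n) * poch F q (Q (+ n)) n) * (gb a k * (1# - Q (+ (n ℕ.+ k))))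
  C-*-lam n a 0<n 2n+a≡N zero _ rewrite ℕₚ.+-identityʳ n = begin
    (1# - Q (+ n)) * (C n * (p * g n n * gb n n))
      ≈⟨ solve 5 (λ x c p h b → x :* (c :* (p :* h :* b)) := c :* h :* p :* b :* x) refl _ _ _ _ _ ⟩
    C n * g n n * p * gb n n * (1# - Q (+ n))
      ≈⟨ *-congʳ (*-cong (*-congʳ (C-*-g n n)) (gb-diag n)) ⟩
    - Q (+ n ℤ.- + n ℤ.* + n) * p * 1# * (1# - Q (+ n))
      ≈⟨ solve 3 (λ x p y → :- x :* p :* con (+ 1) :* y := :- (x :* p) :* (con (+ 1) :* y)) refl _ _ _ ⟩
    - (Q (+ n ℤ.- + n ℤ.* + n) * p) * (gb a 0 * (1# - Q (+ n))) ∎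
    where p = poch F q (Q (+ n)) n
  C-*-lam n a 0<n 2n+a≡N (suc k) k<a rewrite ℕₚ.+-suc n k = *-cancelˡ-nonzero
    (*-nonzero (1-Q-nonzero {suc k} (s≤s z≤n) k<N) (1-Q-nonzero 0<m m<N)) (begin
    (1# - Q (+ suc k)) * (1# - Q (+ m)) * ((1# - Q (+ n)) * (- (Q (ℤ.- + m) * C m) * (p′ * g (suc m) n * gb (suc m) n)))
      ≈⟨ solve 8 (λ k m n y c p h b → k :* m :* (n :* (:- (y :* c) :* (p :* h :* b)))
                    := :- y :* (n :* (c :* (m :* p :* h :* (k :* b))))) refl _ _ _ _ _ _ _ _ ⟩
    - Q (ℤ.- + m) * ((1# - Q (+ n)) * (C m * ((1# - Q (+ m)) * p′ * g (suc m) n * ((1# - Q (+ suc k)) * gb (suc m) n))))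
      -- From m to m + 1 each of the three factors of `lam` changes by a ratio; the multiplier (1 -
      -- q^(k+1)) (1 - qᵐ) clears the denominators.
      ≈⟨ *-congˡ (*-congˡ (*-congˡ (*-cong (*-cong shift-p (g-suc m n)) shift-gb))) ⟩
    - Q (ℤ.- + m) * ((1# - Q (+ n)) * (C m * (p * (1# - Q (+ m ℤ.+ + n)) * (Q (ℤ.- + n) * g m n) * ((1# - Q (+ suc m)) * gb m n))))
      ≈⟨ solve 9 (λ y n c p z w h s b → :- y :* (n :* (c :* (p :* (con (+ 1) :- z) :* (w :* h) :* (s :* b))))
                    := (y :* w :* z :- y :* w) :* s :* (n :* (c :* (p :* h :* b)))) refl _ _ _ _ _ _ _ _ _ ⟩
    (Q (ℤ.- + m) * Q (ℤ.- + n) * Q (+ m ℤ.+ + n) - Q (ℤ.- + m) * Q (ℤ.- + n)) * (1# - Q (+ suc m)) * ((1# - Q (+ n)) * (C m * lam m n))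
      ≈⟨ *-cong (*-congʳ simplify) (C-*-lam n a 0<n 2n+a≡N k (ℕₚ.<⇒≤ k<a)) ⟩
    (1# - Q (+ a ℤ.- + k)) * (1# - Q (+ suc m)) * (- K * (gb a k * (1# - Q (+ m))))
      ≈⟨ solve 5 (λ z s K b m → z :* s :* (:- K :* (b :* m)) := :- K :* (z :* b) :* (m :* s)) refl _ _ _ _ _ ⟩
    - K * ((1# - Q (+ a ℤ.- + k)) * gb a k) * ((1# - Q (+ m)) * (1# - Q (+ suc m)))
      ≈⟨ *-congʳ (*-congˡ (gb-ratio a k)) ⟨
    - K * ((1# - Q (+ suc k)) * gb a (suc k)) * ((1# - Q (+ m)) * (1# - Q (+ suc m)))
      ≈⟨ solve 5 (λ k s K b m → :- K :* (k :* b) :* (m :* s) := k :* m :* (:- K :* (b :* s))) refl _ _ _ _ _ ⟩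
    (1# - Q (+ suc k)) * (1# - Q (+ m)) * (- K * (gb a (suc k) * (1# - Q (+ suc m)))) ∎)
    where
      m = n ℕ.+ k
      p = poch F q (Q (+ m)) n
      p′ = poch F q (Q (+ suc m)) n
      K = Q (+ n ℤ.- + n ℤ.* + n) * poch F q (Q (+ n)) n
      0<m : 0 ℕ.< m
      0<m = ℕₚ.<-≤-trans 0<n (ℕₚ.m≤m+n n k)
      m<n+a : m ℕ.< n ℕ.+ a
      m<n+a = ℕₚ.+-monoʳ-< n k<a
      n+a<N : n ℕ.+ a ℕ.< N
      n+a<N = ≡.subst (n ℕ.+ a ℕ.<_) (≡.trans (≡.sym (ℕₚ.+-assoc n n a)) 2n+a≡N)
                (ℕₚ.m<n+m (n ℕ.+ a) 0<n)
      m<N : m ℕ.< N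
      m<N = ℕₚ.<-trans m<n+a n+a<N
      k<N : suc k ℕ.< N
      k<N = ℕₚ.≤-<-trans (ℕₚ.≤-trans k<a (ℕₚ.m≤n+m a n)) n+a<N
      shift-p : (1# - Q (+ m)) * p′ ≈ p * (1# - Q (+ m ℤ.+ + n))
      shift-p = trans (*-congˡ (poch-cong n (Q-≡ (ℤₚ.+-comm (+ 1) (+ m))))) (poch-shift (+ m) n)
      shift-gb : (1# - Q (+ suc k)) * gb (suc m) n ≈ (1# - Q (+ suc m)) * gb m n
      shift-gb = *-cancelˡ-nonzero (*-nonzero (q!-nonzero n<N) (q!-nonzero (ℕₚ.<-trans ℕₚ.≤-refl k<N))) (begin
        q! n * q! k * ((1# - Q (+ suc k)) * gb (suc m) n)
          ≈⟨ solve 4 (λ a b c d → a :* b :* (c :* d) := a :* (b :* c) :* d) refl _ _ _ _ ⟩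
        q! n * q! (suc k) * gb (suc m) n
          ≡⟨ ≡.cong (λ j → q! n * q! (suc k) * gb j n) (ℕₚ.+-suc n k) ⟨
        q! n * q! (suc k) * gb (n ℕ.+ suc k) n
          ≈⟨ gb-factorial n (suc k) ⟩
        q! (n ℕ.+ suc k)
          ≡⟨ ≡.cong q! (ℕₚ.+-suc n k) ⟩
        q! m * (1# - Q (+ suc m))
          ≈⟨ *-congʳ (gb-factorial n k) ⟨
        q! n * q! k * gb m n * (1# - Q (+ suc m))
          ≈⟨ solve 4 (λ a b c d → a :* b :* c :* d := a :* b :* (d :* c)) refl _ _ _ _ ⟩
        q! n * q! k * ((1# - Q (+ suc m)) * gb m n) ∎)
        where
          n<N : n ℕ.< N
          n<N = ℕₚ.≤-<-trans (ℕₚ.m≤m+n n a) n+a<N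
      eq : ∀ n a k → a ℤ.- k ≡ n ℤ.+ n ℤ.+ a ℤ.+ (ℤ.- (n ℤ.+ k) ℤ.+ ℤ.- n)
      eq = solve-∀
      eq′ : ∀ m n → ℤ.- m ℤ.+ ℤ.- n ℤ.+ (m ℤ.+ n) ≡ + 0
      eq′ = solve-∀
      -- Here q^N = 1 is used: N - m - n = a - k turns 1 - q^(-m-n) into 1 - q^(a-k), the factor by
      -- which `gb-ratio` advances row a.
      simplify : Q (ℤ.- + m) * Q (ℤ.- + n) * Q (+ m ℤ.+ + n) - Q (ℤ.- + m) * Q (ℤ.- + n) ≈ 1# - Q (+ a ℤ.- + k)
      simplify = +-cong
        (trans (*-congʳ (sym (Q-+ (ℤ.- + m) (ℤ.- + n)))) (Q-*-≡ (ℤ.- + m ℤ.+ ℤ.- + n) (+ m ℤ.+ + n) (eq′ (+ m) (+ n))))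
        (-‿cong (trans (sym (Q-+ (ℤ.- + m) (ℤ.- + n)))
          (sym (Q-mod (+ a ℤ.- + k) (ℤ.- + m ℤ.+ ℤ.- + n)
            (≡.trans (eq (+ n) (+ a) (+ k)) (≡.cong (λ j → + j ℤ.+ (ℤ.- + m ℤ.+ ℤ.- + n)) 2n+a≡N))))))

  -- Both sides vanish if 2n > N. Otherwise `lam` confines m to n ≤ m ≤ N - n, and multiplication by
  -- 1 - qⁿ turns the weights into row a = N - 2n, summed by `S-α`.
  ∑-C-α-lam : ∀ n → 0 ℕ.< n → n ℕ.< N →
    ∑ N (λ m → C m * α (+ m) * lam m n) ≈ Q (ℤ.- + (n ℕ.* n)) * poch F q (Q (+ n)) n
  ∑-C-α-lam n 0<n n<N with n ℕ.+ n ℕ.≤? N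
  ... | no 2n≰N = begin
    ∑ N (λ m → C m * α (+ m) * lam m n)
      ≈⟨ ∑-zero< N (λ m m<N → trans (*-congˡ (zero-term m m<N)) (zeroʳ _)) ⟩
    0#
      ≈⟨ zeroʳ _ ⟨
    Q (ℤ.- + (n ℕ.* n)) * 0#
      ≈⟨ *-congˡ (poch-vanish-N n n (ℕₚ.<⇒≤ n<N) N<2n) ⟨
    Q (ℤ.- + (n ℕ.* n)) * poch F q (Q (+ n)) n ∎
    where
      N<2n : N ℕ.< n ℕ.+ n
      N<2n = ℕₚ.≰⇒> 2n≰N
      zero-term : ∀ m → m ℕ.< N → lam m n ≈ 0#
      zero-term m m<N with m ℕ.<? n
      ... | yes m<n = lam-> m n m<n
      ... | no  m≮n = lam-vanish m n (ℕₚ.<⇒≤ m<N) (ℕₚ.<-≤-trans N<2n (ℕₚ.+-monoˡ-≤ n (ℕₚ.≮⇒≥ m≮n)))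
  ... | yes 2n≤N with ℕₚ.m≤n⇒∃[o]m+o≡n 2n≤N
  ... | a , 2n+a≡N = *-cancelˡ-nonzero (1-Q-nonzero 0<n n<N) (begin
    (1# - Q (+ n)) * ∑ N t
      ≈⟨ *-congˡ window ⟩
    (1# - Q (+ n)) * ∑ (suc a) (λ k → t (n ℕ.+ k))
      ≈⟨ *-distribˡ-∑ _ (suc a) _ ⟩
    ∑ (suc a) (λ k → (1# - Q (+ n)) * t (n ℕ.+ k))
      ≈⟨ ∑-cong< (suc a) (λ k k≤a → term k (ℕₚ.≤-pred k≤a)) ⟩
    ∑ (suc a) (λ k → - K * (gb a k * ((1# - Q (+ (n ℕ.+ k))) * α (+ (n ℕ.+ k)))))
      ≈⟨ *-distribˡ-∑ (- K) (suc a) _ ⟨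
    - K * ∑ (suc a) (λ k → gb a k * ((1# - Q (+ (n ℕ.+ k))) * α (+ (n ℕ.+ k))))
      ≈⟨ *-congˡ (trans (sym (S-gb a _)) (S-α n a 2n+a≡N)) ⟩
    - (Q (+ n ℤ.- + n ℤ.* + n) * p) * (1# - Q (ℤ.- + n))
      ≈⟨ *-congʳ (-‿cong (*-congʳ (Q-+ (+ n) (ℤ.- (+ n ℤ.* + n))))) ⟩
    - (Q (+ n) * Q (ℤ.- (+ n ℤ.* + n)) * p) * (1# - Q (ℤ.- + n))
      -- Now -qⁿ (1 - q⁻ⁿ) = 1 - qⁿ restores the factor to be cancelled.
      ≈⟨ solve 4 (λ x y p z → :- (x :* y :* p) :* (con (+ 1) :- z) := (x :* z :- x) :* (y :* p)) refl _ _ _ _ ⟩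
    (Q (+ n) * Q (ℤ.- + n) - Q (+ n)) * (Q (ℤ.- (+ n ℤ.* + n)) * p)
      ≈⟨ *-cong (+-congʳ (Q-inverse (+ n))) (*-congʳ (Q-≡ (≡.cong ℤ.-_ (≡.sym (ℤₚ.pos-* n n))))) ⟩
    (1# - Q (+ n)) * (Q (ℤ.- + (n ℕ.* n)) * p) ∎)
    where
      p = poch F q (Q (+ n)) n
      K = Q (+ n ℤ.- + n ℤ.* + n) * p
      t : ℕ → Carrier
      t m = C m * α (+ m) * lam m n
      -- Exactly r = n - 1 indices m < N lie above N - n; there `lam-vanish` applies.
      window : ∑ N t ≈ ∑ (suc a) (λ k → t (n ℕ.+ k))
      window with ℕₚ.m≤n⇒∃[o]m+o≡n 0<n
      ... | r , 1+r≡n = begin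
        ∑ N t
          ≡⟨ ≡.cong (λ k → ∑ k t) N≡ ⟩
        ∑ (n ℕ.+ suc a ℕ.+ r) t
          ≈⟨ ∑-window n (suc a) r t (λ m m<n → trans (*-congˡ (lam-> m n m<n)) (zeroʳ _)) above ⟩
        ∑ (suc a) (λ k → t (n ℕ.+ k)) ∎
        where
          N≡ : N ≡ n ℕ.+ suc a ℕ.+ r
          N≡ = ℤₚ.+-injective (≡.trans (≡.cong +_ (≡.sym 2n+a≡N))
                 (≡.trans (≡.cong (λ j → + j ℤ.+ + n ℤ.+ + a) (≡.sym 1+r≡n))
                          (eq (+ n) (+ a) (+ r))))
            where
              eq : ∀ n a r → + 1 ℤ.+ r ℤ.+ n ℤ.+ a ≡ n ℤ.+ (+ 1 ℤ.+ a) ℤ.+ r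
              eq = solve-∀
          above : ∀ m → n ℕ.+ suc a ℕ.≤ m → m ℕ.< n ℕ.+ suc a ℕ.+ r → t m ≈ 0#
          above m n+a<m m<N = trans (*-congˡ (lam-vanish m n (ℕₚ.<⇒≤ (≡.subst (m ℕ.<_) (≡.sym N≡) m<N)) N<m+n)) (zeroʳ _)
            where
              N<m+n : N ℕ.< m ℕ.+ n
              N<m+n = ≡.subst (ℕ._< m ℕ.+ n) 2n+a≡N
                (≡.subst₂ ℕ._≤_ (≡.trans (ℕₚ.+-comm (n ℕ.+ suc a) n) (≡.trans (≡.cong (n ℕ.+_) (ℕₚ.+-suc n a))
                    (≡.trans (ℕₚ.+-suc n (n ℕ.+ a)) (≡.cong suc (≡.sym (ℕₚ.+-assoc n n a)))))) ≡.refl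
                  (ℕₚ.+-monoˡ-≤ n n+a<m))
      term : ∀ k → k ℕ.≤ a → (1# - Q (+ n)) * t (n ℕ.+ k) ≈ - K * (gb a k * ((1# - Q (+ (n ℕ.+ k))) * α (+ (n ℕ.+ k))))
      term k k≤a = begin
        (1# - Q (+ n)) * (C (n ℕ.+ k) * α (+ (n ℕ.+ k)) * lam (n ℕ.+ k) n)
          ≈⟨ solve 4 (λ x c a l → x :* (c :* a :* l) := x :* (c :* l) :* a) refl _ _ _ _ ⟩
        (1# - Q (+ n)) * (C (n ℕ.+ k) * lam (n ℕ.+ k) n) * α (+ (n ℕ.+ k))
          ≈⟨ *-congʳ (C-*-lam n a 0<n 2n+a≡N k k≤a) ⟩
        - K * (gb a k * (1# - Q (+ (n ℕ.+ k)))) * α (+ (n ℕ.+ k))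
          ≈⟨ solve 4 (λ K b x a → K :* (b :* x) :* a := K :* (b :* (x :* a))) refl _ _ _ _ ⟩
        - K * (gb a k * ((1# - Q (+ (n ℕ.+ k))) * α (+ (n ℕ.+ k)))) ∎

  -- The exceptional index n = 0.

  -- As C (m+1) qᵐ = -C m, `α-suc` makes each later summand the difference of C m · X⁺ m at
  -- consecutive indices. The constant 1 is -C 0 · X⁺ 0, the summand at 0 being zero.
  ∑-C-α-telescope : ∀ n → ∑ (suc n) (λ m → C m * α (+ m)) ≈ C n * X⁺ n + 1#
  ∑-C-α-telescope zero    =
    solve 0 (con (+ 0) :+ :- con (+ 1) :* (con (+ 1) :- con (+ 1) :* con (+ 1))
             := :- con (+ 1) :* con (+ 1) :+ con (+ 1)) refl
  ∑-C-α-telescope (suc n) = begin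
    ∑ (suc n) (λ m → C m * α (+ m)) + C (suc n) * α (+ suc n)
      ≈⟨ +-cong (∑-C-α-telescope n) (*-congˡ (α-suc n)) ⟩
    C n * X⁺ n + 1# + - (Q (ℤ.- + n) * C n) * (X⁺ (suc n) + Q (+ n) * X⁺ n)
      ≈⟨ solve 5 (λ c x y z w → c :* x :+ con (+ 1) :+ :- (y :* c) :* (z :+ w :* x)
                    := :- (y :* c) :* z :+ con (+ 1) :+ (c :* x :- w :* y :* (c :* x))) refl _ _ _ _ _ ⟩
    C (suc n) * X⁺ (suc n) + 1# + (C n * X⁺ n - Q (+ n) * Q (ℤ.- + n) * (C n * X⁺ n))
      ≈⟨ +-congˡ (+-congˡ (-‿cong (*-congʳ (Q-inverse (+ n))))) ⟩
    C (suc n) * X⁺ (suc n) + 1# + (C n * X⁺ n - 1# * (C n * X⁺ n))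
      ≈⟨ solve 2 (λ x y → x :+ (y :- con (+ 1) :* y) := x) refl _ _ ⟩
    C (suc n) * X⁺ (suc n) + 1# ∎

  -- Row 2N of `S-X` folds to the four terms X N + X 0 + X 0 + X(-N) = 1, and the first reflection
  -- with q^N = 1 evaluates X(-N).
  X-N : X⁺ N ≈ Q (+ N′) * X⁺ N′ - 1#
  X-N = begin
    X⁺ N
      ≈⟨ solve 2 (λ x y → x := x :+ con (+ 1) :+ (con (+ 1) :+ :- y) :+ y :- (con (+ 1) :+ con (+ 1))) refl _ y ⟩
    X⁺ N + 1# + (1# + - y) + y - (1# + 1#)
      ≈⟨ +-congʳ (+-congʳ S-X-N) ⟩
    1# + y - (1# + 1#)
      ≈⟨ solve 1 (λ y → con (+ 1) :+ y :- (con (+ 1) :+ con (+ 1)) := y :- con (+ 1)) refl _ ⟩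
    y - 1# ∎
    where
      y = Q (+ N′) * X⁺ N′
      f : ℕ → Carrier
      f k = X (+ N ℤ.- + k)
      eq₀ : ∀ n → n ℤ.- + 0 ≡ n
      eq₀ = solve-∀
      eq₁ : ∀ n → n ℤ.- (n ℤ.+ + 0) ≡ + 0
      eq₁ = solve-∀
      eq₂ : ∀ n → n ℤ.- n ≡ + 0
      eq₂ = solve-∀
      eq₃ : ∀ n → n ℤ.- (n ℤ.+ n) ≡ ℤ.- n
      eq₃ = solve-∀
      eq₄ : ∀ n → n ℤ.+ ℤ.- (+ 1 ℤ.+ n) ≡ ℤ.- + 1
      eq₄ = solve-∀
      X-neg-N : X (ℤ.- + N) ≈ - y
      X-neg-N = begin
        X (ℤ.- + N)
          ≈⟨ *-identityˡ _ ⟨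
        1# * X (ℤ.- + N)
          ≈⟨ *-congʳ (trans (sym (Q-+N (ℤ.- + N))) (Q-inverse-N)) ⟨
        Q (ℤ.- + N) * X (ℤ.- + N)
          ≈⟨ QX-reflect-1 (+ N′) (ℤ.- + N) (eq₄ (+ N′)) ⟩
        - y ∎
        where
          Q-inverse-N : Q (+ N ℤ.+ ℤ.- + N) ≈ 1#
          Q-inverse-N = Q-≡ (ℤₚ.+-inverseʳ (+ N))
      S-X-N : X⁺ N + 1# + (1# + - y) ≈ 1#
      S-X-N = begin
        X⁺ N + 1# + (1# + - y)
          ≈⟨ +-cong (+-cong (X-≡ (eq₀ (+ N))) (X-≡ (eq₁ (+ N))))
                    (+-cong (X-≡ (eq₂ (+ N))) (trans (X-≡ (eq₃ (+ N))) X-neg-N)) ⟨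
        f 0 + f (N ℕ.+ 0) + (f N + f (N ℕ.+ N))
          ≈⟨ S-N (λ k → f k + f (N ℕ.+ k)) ⟨
        S N (λ k → f k + f (N ℕ.+ k))
          ≈⟨ S-+N N f ⟨
        S (N ℕ.+ N) f
          ≈⟨ S-X N ⟩
        1# ∎

  -- With y = q^(N-1) X⁺ (N-1), `C-N` turns the telescoped sum into 1 - y, while `X-N` gives α N =
  -- 2y - 1; eliminating y produces the halves.
  ∑-C-α : ∑ N (λ m → C m * α (+ m)) ≈ half F - half F * α (+ N)
  ∑-C-α = begin
    ∑ N (λ m → C m * α (+ m))
      ≈⟨ ∑-C-α-telescope N′ ⟩
    C N′ * X⁺ N′ + 1#
      ≈⟨ +-congʳ (*-congʳ C-N′) ⟩
    - Q (+ N′) * X⁺ N′ + 1#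
      ≈⟨ solve 2 (λ x y → :- x :* y :+ con (+ 1) := con (+ 1) :- x :* y) refl _ _ ⟩
    1# - y
      -- The solver does not know that h + h = 1, so the defect is kept as a last summand and
      -- removed afterwards.
      ≈⟨ solve 2 (λ h y → con (+ 1) :- y
            := h :- h :* (y :- con (+ 1) :+ y) :+ (con (+ 1) :- (h :+ h)) :* (con (+ 1) :- y)) refl (half F) y ⟩
    half F - half F * (y - 1# + y) + (1# - (half F + half F)) * (1# - y)
      ≈⟨ +-cong (+-congˡ (-‿cong (*-congˡ (trans (+-congʳ (sym X-N)) (sym (α-suc N′))))))
                (*-congʳ (+-congˡ (-‿cong half+half))) ⟩
    half F - half F * α (+ N) + (1# - 1#) * (1# - y)
      ≈⟨ solve 2 (λ x z → x :+ (con (+ 1) :- con (+ 1)) :* z := x) refl _ _ ⟩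
    half F - half F * α (+ N) ∎
    where
      y = Q (+ N′) * X⁺ N′
      C-N′ : C N′ ≈ - Q (+ N′)
      C-N′ = begin
        C N′
          ≈⟨ *-identityˡ _ ⟨
        1# * C N′
          ≈⟨ *-congʳ (Q-inverse (+ N′)) ⟨
        Q (+ N′) * Q (ℤ.- + N′) * C N′
          ≈⟨ solve 3 (λ x y c → x :* y :* c := :- x :* :- (y :* c)) refl _ _ _ ⟩
        - Q (+ N′) * C N
          ≈⟨ trans (*-congˡ C-N) (*-identityʳ _) ⟩
        - Q (+ N′) ∎

  -- Truncation of the outer sum and comparison of both sides.

  C-suc : ∀ k → C (suc k) ≈ pow F (- 1#) k * Q (ℤ.- + (suc k choose 2))
  C-suc zero    = solve 0 (:- (con (+ 1) :* :- con (+ 1)) := con (+ 1) :* con (+ 1)) refl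
  C-suc (suc k) = begin
    - (Q (ℤ.- + suc k) * C (suc k))
      ≈⟨ -‿cong (*-congˡ (C-suc k)) ⟩
    - (Q (ℤ.- + suc k) * (pow F (- 1#) k * Q (ℤ.- + (suc k choose 2))))
      ≈⟨ solve 3 (λ x s y → :- (x :* (s :* y)) := :- con (+ 1) :* s :* (x :* y)) refl _ _ _ ⟩
    pow F (- 1#) (suc k) * (Q (ℤ.- + suc k) * Q (ℤ.- + (suc k choose 2)))
      ≈⟨ *-congˡ (Q-*-≡ (ℤ.- + suc k) (ℤ.- + (suc k choose 2))
           (≡.trans (≡.sym (ℤₚ.neg-distrib-+ (+ suc k) (+ (suc k choose 2)))) (≡.cong (λ n → ℤ.- + n) choose-suc))) ⟩
    pow F (- 1#) (suc k) * Q (ℤ.- + (suc (suc k) choose 2)) ∎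
    where
      choose-suc : suc k ℕ.+ suc k choose 2 ≡ suc (suc k) choose 2
      choose-suc = ≡.trans (≡.cong (ℕ._+ suc k choose 2) (≡.sym (nC1≡n (suc k)))) (nCk+nC[k+1]≡[n+1]C[k+1] (suc k) 1)

  -- Among n ≥ N consecutive exponents one is a multiple of N; reducing n modulo N locates it. The
  -- outer sum therefore stops before N.
  poch-vanish-≥ : ∀ n → N ℕ.≤ n → poch F q (Q (+ n)) n ≈ 0#
  poch-vanish-≥ n N≤n = trans (poch-cong n (Q-% n)) (vanish (n ℕ.% N) (DM.m%n<n n N))
    where
      Q-% : ∀ n → Q (+ n) ≈ Q (+ (n ℕ.% N))
      Q-% n = begin
        Q (+ n)
          ≡⟨ ≡.cong (λ m → Q (+ m)) (DM.m≡m%n+[m/n]*n n N) ⟩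
        Q (+ (n ℕ.% N) ℤ.+ + (n ℕ./ N ℕ.* N))
          ≈⟨ Q-+ (+ (n ℕ.% N)) (+ (n ℕ./ N ℕ.* N)) ⟩
        Q (+ (n ℕ.% N)) * Q (+ (n ℕ./ N ℕ.* N))
          ≈⟨ *-congˡ (trans (Q-≡ (ℤₚ.pos-* (n ℕ./ N) N))
               (trans (sym (pow-Q (+ N) (n ℕ./ N))) (trans (pow-cong (n ℕ./ N) Q-N) (pow-1 (n ℕ./ N))))) ⟩
        Q (+ (n ℕ.% N)) * 1#
          ≈⟨ *-identityʳ _ ⟩
        Q (+ (n ℕ.% N)) ∎
      vanish : ∀ r → r ℕ.< N → poch F q (Q (+ r)) n ≈ 0#
      vanish zero    _   = poch-vanish n 0 (ℕₚ.<-≤-trans (s≤s z≤n) N≤n) (*-identityˡ _)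
      vanish (suc r) r<N = poch-vanish-N (suc r) n (ℕₚ.<⇒≤ r<N) (s≤s (ℕₚ.≤-trans N≤n (ℕₚ.m≤n+m n r)))

  module Evaluation (p : ℕ) where
    G : ℕ → Carrier
    G = chainSum F q p

    -- By `C-N` and q^N = 1 the summand at m = N would be α N, so the ½ α N that accompanies this
    -- sum is an end point with half weight, as in the trapezoidal rule.
    trapezoid : Carrier
    trapezoid = ∑ N (λ m → C m * α (+ m) * Q (+ suc p ℤ.* (+ m ℤ.* + m)))

    ∑-K-G : ∑ N (λ n → ∑ N (λ m → C m * α (+ m) * lam m n) * G n) ≈ trapezoid
    ∑-K-G = begin
      ∑ N (λ n → ∑ N (λ m → C m * α (+ m) * lam m n) * G n)
        ≈⟨ ∑-cong N (λ n → *-distribʳ-∑ (G n) N _) ⟩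
      ∑ N (λ n → ∑ N (λ m → C m * α (+ m) * lam m n * G n))
        ≈⟨ ∑-swap N N _ ⟩
      ∑ N (λ m → ∑ N (λ n → C m * α (+ m) * lam m n * G n))
        ≈⟨ ∑-cong N (λ m → trans (∑-cong N (λ n → *-assoc _ _ _)) (sym (*-distribˡ-∑ _ N _))) ⟩
      ∑ N (λ m → C m * α (+ m) * ∑ N (λ n → lam m n * G n))
        ≈⟨ ∑-cong< N (λ m m<N → *-congˡ (∑-lam-chainSum p m m<N)) ⟩
      trapezoid ∎

    H10-trapezoid : ∀ M → N ℕ.≤ M → H10 F q (suc p) M ≈ half F + half F * α (+ N) + trapezoid
    H10-trapezoid M N≤M with ℕₚ.m≤n⇒∃[o]m+o≡n (ℕₚ.m≤n⇒m≤1+n N≤M)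
    ... | r , N+r≡1+M = begin
      ∑ (suc M) t
        ≡⟨ ≡.cong (λ k → ∑ k t) N+r≡1+M ⟨
      ∑ (N ℕ.+ r) t
        ≈⟨ ∑-window 0 N r t (λ _ ()) (λ n N≤n _ →
             trans (*-congʳ (trans (*-congˡ (poch-vanish-≥ n N≤n)) (zeroʳ _))) (zeroˡ _)) ⟩
      ∑ N t
        ≈⟨ ∑-head N′ t ⟩
      1# * 1# * G 0 + ∑ N′ (λ n → t (suc n))
        ≈⟨ +-cong t-0 (∑-cong< N′ (λ n n<N′ → *-congʳ (sym (∑-C-α-lam (suc n) (s≤s z≤n) (s≤s n<N′))))) ⟩
      half F + half F * α (+ N) + K 0 * G 0 + ∑ N′ (λ n → K (suc n) * G (suc n))
        ≈⟨ +-assoc _ _ _ ⟩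
      half F + half F * α (+ N) + (K 0 * G 0 + ∑ N′ (λ n → K (suc n) * G (suc n)))
        ≈⟨ +-congˡ (trans (sym (∑-head N′ _)) ∑-K-G) ⟩
      half F + half F * α (+ N) + trapezoid ∎
      where
        t K : ℕ → Carrier
        t n = Q (ℤ.- + (n ℕ.* n)) * poch F q (Q (+ n)) n * G n
        K n = ∑ N (λ m → C m * α (+ m) * lam m n)
        K-0 : K 0 * G 0 ≈ half F - half F * α (+ N)
        K-0 = trans (*-cong (trans (∑-cong N (λ m → trans (*-congˡ (lam-0 m)) (*-identityʳ _))) ∑-C-α) (chainSum-0 p))
                    (*-identityʳ _)
        -- The summand at n = 0 is 1 but K 0 is only ½ - ½ α N; the deficit is split off so that
        -- `∑-K-G` covers all n < N.
        t-0 : 1# * 1# * G 0 ≈ half F + half F * α (+ N) + K 0 * G 0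
        t-0 = begin
          1# * 1# * G 0
            ≈⟨ trans (*-cong (*-identityˡ _) (chainSum-0 p)) (*-identityˡ _) ⟩
          1#
            ≈⟨ half+half ⟨
          half F + half F
            ≈⟨ solve 2 (λ h a → h :+ h := h :+ h :* a :+ (h :- h :* a)) refl _ (α (+ N)) ⟩
          half F + half F * α (+ N) + (half F - half F * α (+ N))
            ≈⟨ +-congˡ K-0 ⟨
          half F + half F * α (+ N) + K 0 * G 0 ∎

    -- With m = k + 1, the prefactor q^P completes the square, P + P(k² + 2k) = P m², and cancels
    -- q^(-P) at the end point.
    rhs216-trapezoid : rhs216 F q N (suc p) ≈ half F * α (+ N) + trapezoid
    rhs216-trapezoid = begin
      pow F q P * (∑ N′ u + half F * Q (ℤ.- + P) * alphaHat F q N′)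
        ≈⟨ solve 5 (λ x s h y a → x :* (s :+ h :* y :* a) := x :* y :* (h :* a) :+ x :* s) refl _ _ _ _ _ ⟩
      Q (+ P) * Q (ℤ.- + P) * (half F * alphaHat F q N′) + Q (+ P) * ∑ N′ u
        ≈⟨ +-cong (trans (*-cong (Q-inverse (+ P)) (*-congˡ (alphaHat-α N′))) (*-identityˡ _)) (*-distribˡ-∑ _ N′ u) ⟩
      half F * α (+ N) + ∑ N′ (λ k → Q (+ P) * u k)
        ≈⟨ +-congˡ (∑-cong N′ term) ⟩
      half F * α (+ N) + ∑ N′ (λ k → v (suc k))
        ≈⟨ +-congˡ (+-identityˡ _) ⟨
      half F * α (+ N) + (0# + ∑ N′ (λ k → v (suc k)))
        ≈⟨ +-congˡ (trans (+-congʳ (sym v-0)) (sym (∑-head N′ v))) ⟩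
      half F * α (+ N) + trapezoid ∎
      where
        P = suc p
        u v : ℕ → Carrier
        u k = pow F (- 1#) k * Q (ℤ.- + (suc k choose 2) ℤ.+ + (P ℕ.* (k ℕ.* k ℕ.+ 2 ℕ.* k))) * alphaHat F q k
        v m = C m * α (+ m) * Q (+ P ℤ.* (+ m ℤ.* + m))
        v-0 : v 0 ≈ 0#
        v-0 = solve 1 (λ x → :- con (+ 1) :* (con (+ 1) :- con (+ 1) :* con (+ 1)) :* x := con (+ 0)) refl _
        eq : ∀ P k → P ℤ.+ P ℤ.* (k ℤ.* k ℤ.+ + 2 ℤ.* k) ≡ P ℤ.* ((+ 1 ℤ.+ k) ℤ.* (+ 1 ℤ.+ k))
        eq = solve-∀
        E≡ : ∀ k → + P ℤ.+ + (P ℕ.* (k ℕ.* k ℕ.+ 2 ℕ.* k)) ≡ + P ℤ.* (+ suc k ℤ.* + suc k)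
        E≡ k = ≡.trans (≡.cong (λ i → + P ℤ.+ i) (≡.trans (ℤₚ.pos-* P (k ℕ.* k ℕ.+ 2 ℕ.* k))
                 (≡.cong (λ i → + P ℤ.* i) (≡.cong₂ ℤ._+_ (ℤₚ.pos-* k k) (ℤₚ.pos-* 2 k))))) (eq (+ P) (+ k))
        term : ∀ k → Q (+ P) * u k ≈ v (suc k)
        term k = begin
          Q (+ P) * (pow F (- 1#) k * Q (B ℤ.+ E) * alphaHat F q k)
            ≈⟨ *-congˡ (*-cong (*-congˡ (Q-+ B E)) (alphaHat-α k)) ⟩
          Q (+ P) * (pow F (- 1#) k * (Q B * Q E) * α (+ suc k))
            ≈⟨ solve 5 (λ x s b e a → x :* (s :* (b :* e) :* a) := s :* b :* a :* (x :* e)) refl _ _ _ _ _ ⟩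
          pow F (- 1#) k * Q B * α (+ suc k) * (Q (+ P) * Q E)
            ≈⟨ *-cong (*-congʳ (sym (C-suc k))) (Q-*-≡ (+ P) E (E≡ k)) ⟩
          v (suc k) ∎
          where
            B = ℤ.- + (suc k choose 2)
            E = + (P ℕ.* (k ℕ.* k ℕ.+ 2 ℕ.* k))

theorem2p16 : {c ℓ : Level} (F : Field0 c ℓ) (N : ℕ) → 1 ≤ N → (q : Field0.Carrier F) →
    PrimitiveRoot F N q → (p : ℕ) → 1 ≤ p → (M : ℕ) → N ≤ M →
    Field0._≈_ F (Field0._+_ F (Field0.-_ F (half F)) (H10 F q p M)) (rhs216 F q N p)
theorem2p16 F (suc N′) 1≤N q root (suc p) 1≤p M N≤M = begin
  - half F + H10 F q (suc p) M
    ≈⟨ +-congˡ (H10-trapezoid M N≤M) ⟩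
  - half F + (half F + half F * α (+ suc N′) + trapezoid)
    ≈⟨ solve 3 (λ h x y → :- h :+ (h :+ x :+ y) := x :+ y) refl _ _ _ ⟩
  half F * α (+ suc N′) + trapezoid
    ≈⟨ rhs216-trapezoid ⟨
  rhs216 F q (suc N′) (suc p) ∎
  where
    open Field0 F
    open import Relation.Binary.Reasoning.Setoid setoid
    open FieldArithmetic F
    open FalseTheta F q (RootOfUnity.q≉0 F N′ q root) using (α)
    open RootOfUnity.Evaluation F N′ q root p
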